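{- For every positive integer $r$, $r-2 \le \pi^*(S_r) \le r + 2\sqrt{r} + 6$.
   Context: For a positive integer $n$, $[n]=\{1,\dots,n\}$ and $\mathcal{B}_n$ denotes the family of all subsets of $[n]$ ordered by inclusion. A poset $P$ is a subposet of $Q$ if $P\subseteq Q$ and $x\le_P y$ iff $x\le_Q y$; a family $\mathcal{F}\subseteq\mathcal{B}_n$ contains a copy of $P$ if some subposet of $(\mathcal{F},\subseteq)$ is isomorphic to $P$, and is $P$-free otherwise. ${\rm La}^*(n,P)$ is the maximum size of a $P$-free family $\mathcal{F}\subseteq\mathcal{B}_n$, and $\pi^*(P)=\limsup_{n\to\infty}{\rm La}^*(n,P)/\binom{n}{\lfloor n/2\rfloor}$. The standard example $S_r$ is the poset on $2r$ elements $a_1,\dots,a_r,b_1,\dots,b_r$ in which $\{a_i\}$ and $\{b_j\}$ are antichains and $b_j\le a_i$ iff $i\ne j$ (no other relations). -}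

module Defs where

open import Data.Nat using (ℕ; ⌊_/2⌋) renaming (_≥_ to _≥ℕ_)
open import Data.Nat.Combinatorics using (_C_)
open import Data.Fin using (Fin)
open import Data.Fin.Subset using (Subset; _⊆_)
open import Data.Sum using (_⊎_; inj₁; inj₂)
open import Data.Product using (Σ; _×_; ∃; ∃-syntax)
open import Data.List using (List; length)
open import Data.List.Relation.Unary.Unique.Propositional using (Unique)
import Data.List.Membership.Propositional as L
open import Data.Integer using (+_)
open import Data.Rational using (ℚ; _/_; _+_; _*_; _≤_; Positive; NonNegative)
open import Relation.Binary.PropositionalEquality using (_≡_; _≢_)
open import Relation.Nullary using (¬_)
open import Function.Base using (_∘_)
open import Function.Definitions using (Injective)
open import Level using (0ℓ)

ℕ→ℚ : ℕ → ℚ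
ℕ→ℚ n = + n / 1

record Family (n : ℕ) : Set where
  constructor family
  field
    members  : List (Subset n)
    distinct : Unique members

open Family public

size : ∀ {n} → Family n → ℕ
size F = length (members F)

-- The standard example S_r: carrier Fin r ⊎ Fin r, where inj₁ i = a_i and inj₂ j = b_j.
-- Order: reflexive on each element; b_j ≤ a_i iff i ≠ j; nothing else.
data _≤S_ {r : ℕ} : Fin r ⊎ Fin r → Fin r ⊎ Fin r → Set where
  a≤a : ∀ {i} → inj₁ i ≤S inj₁ i
  b≤b : ∀ {j} → inj₂ j ≤S inj₂ j
  b≤a : ∀ {i j} → i ≢ j → inj₂ j ≤S inj₁ i

ContainsS : (r : ℕ) {n : ℕ} → Family n → Set
ContainsS r {n} F =
  Σ (Fin r ⊎ Fin r → Subset n) λ f →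
    Injective _≡_ _≡_ f ×
    (∀ x → f x L.∈ members F) ×
    (∀ x y → (x ≤S y → f x ⊆ f y) × (f x ⊆ f y → x ≤S y))

S-free : (r : ℕ) {n : ℕ} → Family n → Set
S-free r F = ¬ ContainsS r F

_≤·mid_ : ∀ {n} → Family n → ℚ → Set
_≤·mid_ {n} F c = ℕ→ℚ (size F) ≤ c * ℕ→ℚ (n C ⌊ n /2⌋)

-- c ≤ π*(S_r) := limsup La*(n,S_r)/binom(n,⌊n/2⌋): for every ε > 0 and every N there
-- are n ≥ N and an S_r-free family F ⊆ B_n with |F| ≥ (c - ε)·binom(n,⌊n/2⌋).
-- (Written as |F| + ε·binom ≥ c·binom to avoid subtraction.)
LowerBoundπ* : (r : ℕ) → ℚ → Set
LowerBoundπ* r c =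
  (ε : ℚ) → Positive ε → (N : ℕ) →
    ∃[ n ] (n ≥ℕ N × Σ (Family n) λ F → S-free r F ×
      (c * ℕ→ℚ (n C ⌊ n /2⌋) ≤ (ℕ→ℚ (size F) + ε * ℕ→ℚ (n C ⌊ n /2⌋))))

UpperBoundπ* : (r : ℕ) → ℚ → Set
UpperBoundπ* r c =
  (ε : ℚ) → Positive ε →
    ∃[ N ] ((n : ℕ) → n ≥ℕ N → (F : Family n) → S-free r F → F ≤·mid (c + ε))

{-# OPTIONS --safe #-}

-- Upper bound, in fact with r + 2. For a family F say that e ∉ A is bad for A if no b ∈ F satisfies
-- e ∈ b ⊆ A ∪ {e}, and dually that e ∈ B is bad for B if no a ∈ F satisfies B ∖ {e} ⊆ a ∌ e. If A ⊆ B
-- and r + 1 elements of B ∖ A are bad for neither, the corresponding b's and a's contain a copy of S_r.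
-- Each U has at most one e ∈ U such that U ∖ {e} ∈ F and e is bad for U ∖ {e}; hence, after discarding
-- the tails of the cube, a random element outside a random A ∈ F is bad with probability O(δ), where δn
-- bounds the number of levels used, and dually. By the ballot theorem, along a random maximal chain
-- through A the bad elements then almost never make up a proportion 1/(r + 2) of the elements following
-- A, or of those preceding it. Two members of F on one chain for which neither happens are less than
-- r + 2 levels apart, so a chain has at most r + 2 of them, and the LYM inequality gives the bound.
--
-- Lower bound: if bⱼ ∖ aⱼ ∋ eⱼ, then a₁ contains b₀ and the r − 2 further points e₂, …, so S_r does not
-- fit into r − 2 consecutive levels.
module Submission where

open import Defs

-- Why a ballot theorem: two members of the family on one chain may be any distance apart, so bad
-- elements must be sparse in every initial segment after `A` at once. Markov's inequality for each
-- length and a union bound would lose a factor of order n. But badness for `A` depends on `A` and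
-- the family alone, and given `A` the later elements of a random chain come in uniformly random
-- order; so the probability that some initial segment has a proportion 1/M of bad elements is at
-- most M times the overall proportion, with no loss in the length. Where O(δ) comes from: a pair
-- (A, e) with e bad for A is charged to A ∪ {e}. Each set is charged at most once, while A has
-- about n/2 candidates e. So the bad proportions, summed over the family with weight 1/C(n,|A|),
-- amount to at most (number of levels)/`lo`, with `lo` close to n/2. This is small only when few
-- levels occur, which is why the tails are cut off first. The count stays in the naturals:
-- probabilities are multiplied by n!, the tolerance is 1/k, and denominators are cleared.

module Counting where

  open import Data.Nat
  open import Data.Nat.Properties
  open import Data.Nat.Combinatorics using (_C_; nCk≡n!/k![n-k]!; k![n∸k]!∣n!; nCk≡nC[n∸k]; k>n⇒nCk≡0; nCk+nC[k+1]≡[n+1]C[k+1])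
  open import Data.Nat.DivMod using (_/_; _%_; m≡m%n+[m/n]*n; m%n<n; m/n*n≤m; m/n*n≡m; m*n/n≡m; /-monoˡ-≤)
  open import Data.Nat.Tactic.RingSolver using (solve-∀)
  open import Data.Bool using (Bool; true; false; not; _∧_; _∨_; T)
  import Data.Bool as Bool
  open import Data.Fin using (Fin; zero; suc; toℕ; inject≤)
  import Data.Fin as Fin
  import Data.Fin.Properties as Fin
  open import Data.Fin.Subset using (Subset; ∁; ∣_∣; inside; outside; _∈_; _∉_; _⊆_) renaming (⊥ to ∅; ⊤ to full)
  open import Data.Fin.Subset.Properties using (∣∁p∣≡n∸∣p∣; ∣p∣≤n; ∣⊤∣≡n; ∉⊥; p⊆q⇒∣p∣≤∣q∣; _∈?_; _⊆?_; anySubset?)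
  open import Data.Vec as Vec using (lookup; []; _∷_; _[_]≔_)
  open import Data.Vec.Properties using (≡-dec; ∷-injectiveʳ; lookup-map; lookup∘updateAt; lookup∘updateAt′; []≔-commutes; []≔-idempotent; []≔-lookup; []≔-minimal; []≔-updates; []=⇒lookup; lookup⇒[]=)
  open import Data.List using (List; []; _∷_; _∷ʳ_; _++_; _ʳ++_; reverse; length; take; drop; map; filter; foldl)
  import Data.List as List
  open import Data.List.Properties using (length-++; length-take; length-drop; length-reverse; filter-++; take++drop≡id; unfold-reverse; reverse-++; reverse-injective; ʳ++-ʳ++; ʳ++-defn; ++-identityʳ)
  import Data.List.Membership.Propositional as L
  import Data.List.Membership.DecPropositional as DecMembership
  open import Data.List.Membership.Propositional.Properties using (∈-++⁺ˡ; ∈-++⁺ʳ; ∈-filter⁻; ∈-lookup; ∈-map⁻)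
  open import Data.List.Relation.Unary.Any using (here; there)
  open import Data.List.Relation.Unary.All as All using ([]; _∷_)
  open import Data.List.Relation.Unary.AllPairs using ([]; _∷_)
  open import Data.List.Relation.Unary.Unique.Propositional using (Unique)
  import Data.List.Relation.Unary.Unique.Propositional.Properties as Unique
  open import Data.Product using (Σ; ∃; _×_; _,_; proj₁; proj₂)
  open import Data.Sum using (_⊎_; inj₁; inj₂)
  open import Algebra.Properties.Semiring.Sum +-*-semiring
    using (sum; sum-cong-≗; ∑-distrib-+; ∑-comm; *-distribˡ-sum; *-distribʳ-sum; sum-replicate-zero)
  open import Function.Base using (_∘_; const)
  open import Function.Definitions using (Injective)
  open import Relation.Nullary using (¬_; Dec; yes; no; does; contradiction)
  open import Relation.Nullary.Decidable using (_×-dec_; _→-dec_; ¬?; dec-true; decidable-stable)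
  open import Relation.Binary.PropositionalEquality

  -- Sums over subsets and over orderings

  χ : Bool → ℕ
  χ false = 0
  χ true  = 1

  -- Under an indicator the terms have to agree only where it is 1; this is how membership facts
  -- reach the summands.
  χ-cong : ∀ b {x y} → (b ≡ true → x ≡ y) → χ b * x ≡ χ b * y
  χ-cong false _ = refl
  χ-cong true  e = cong (1 *_) (e refl)

  χ-mono : ∀ b {x y} → (b ≡ true → x ≤ y) → χ b * x ≤ χ b * y
  χ-mono false _ = z≤n
  χ-mono true  e = *-monoʳ-≤ 1 (e refl)

  χ≤1 : ∀ b → χ b ≤ 1
  χ≤1 false = z≤n
  χ≤1 true  = ≤-refl

  sum-mono : ∀ {n} {f g : Fin n → ℕ} → (∀ i → f i ≤ g i) → sum f ≤ sum g
  sum-mono {zero}  _   = z≤n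
  sum-mono {suc n} f≤g = +-mono-≤ (f≤g zero) (sum-mono (f≤g ∘ suc))

  sum-const : ∀ n c → sum {n} (const c) ≡ n * c
  sum-const zero    c = refl
  sum-const (suc n) c = cong (c +_) (sum-const n c)

  sum-last : ∀ N (g : ℕ → ℕ) → sum {suc N} (g ∘ toℕ) ≡ sum {N} (g ∘ toℕ) + g N
  sum-last zero    g = +-identityʳ _
  sum-last (suc N) g = trans (cong (g 0 +_) (sum-last N (g ∘ suc))) (sym (+-assoc (g 0) _ _))

  ΣS : ∀ {n} → (Subset n → ℕ) → ℕ
  ΣS {zero}  f = f []
  ΣS {suc n} f = ΣS (f ∘ (outside ∷_)) + ΣS (f ∘ (inside ∷_))

  ΣS-mono : ∀ {n} {f g : Subset n → ℕ} → (∀ A → f A ≤ g A) → ΣS f ≤ ΣS g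
  ΣS-mono {zero}  f≤g = f≤g []
  ΣS-mono {suc n} f≤g = +-mono-≤ (ΣS-mono (f≤g ∘ (outside ∷_))) (ΣS-mono (f≤g ∘ (inside ∷_)))

  ΣS-cong : ∀ {n} {f g : Subset n → ℕ} → (∀ A → f A ≡ g A) → ΣS f ≡ ΣS g
  ΣS-cong f≡g = ≤-antisym (ΣS-mono (≤-reflexive ∘ f≡g)) (ΣS-mono (≤-reflexive ∘ sym ∘ f≡g))

  *-left-comm : ∀ a b c → a * (b * c) ≡ b * (a * c)
  *-left-comm = solve-∀

  private
    interchange : ∀ a b c d → (a + b) + (c + d) ≡ (a + c) + (b + d)
    interchange = solve-∀

  ΣS-distrib-+ : ∀ {n} (f g : Subset n → ℕ) → ΣS (λ A → f A + g A) ≡ ΣS f + ΣS g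
  ΣS-distrib-+ {zero}  f g = refl
  ΣS-distrib-+ {suc n} f g = trans
    (cong₂ _+_ (ΣS-distrib-+ (f ∘ (outside ∷_)) _) (ΣS-distrib-+ (f ∘ (inside ∷_)) _))
    (interchange (ΣS (f ∘ (outside ∷_))) _ _ _)

  *-distribˡ-ΣS : ∀ {n} c (f : Subset n → ℕ) → c * ΣS f ≡ ΣS (λ A → c * f A)
  *-distribˡ-ΣS {zero}  c f = refl
  *-distribˡ-ΣS {suc n} c f = trans (*-distribˡ-+ c (ΣS (f ∘ (outside ∷_))) _)
    (cong₂ _+_ (*-distribˡ-ΣS c (f ∘ (outside ∷_))) (*-distribˡ-ΣS c (f ∘ (inside ∷_))))

  ΣS-sum-comm : ∀ {n m} (f : Subset n → Fin m → ℕ) →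
    ΣS (λ A → sum (f A)) ≡ sum (λ e → ΣS (λ A → f A e))
  ΣS-sum-comm {zero}  f = refl
  ΣS-sum-comm {suc n} f = trans
    (cong₂ _+_ (ΣS-sum-comm (f ∘ (outside ∷_))) (ΣS-sum-comm (f ∘ (inside ∷_))))
    (sym (∑-distrib-+ (λ e → ΣS (λ A → f (outside ∷ A) e)) _))

  infixl 7 _⊖_ _⊕_

  _⊖_ _⊕_ : ∀ {n} → Subset n → Fin n → Subset n
  A ⊖ e = A [ e ]≔ outside
  A ⊕ e = A [ e ]≔ inside

  ⊖-⊕ : ∀ {n} (U : Subset n) e → lookup U e ≡ true → U ⊖ e ⊕ e ≡ U
  ⊖-⊕ U e e∈U = trans ([]≔-idempotent U e) (trans (cong (U [ e ]≔_) (sym e∈U)) ([]≔-lookup U e))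

  lookup-⊖ : ∀ {n} (A : Subset n) e → lookup (A ⊖ e) e ≡ false
  lookup-⊖ A e = lookup∘updateAt e A

  lookup-⊕ : ∀ {n} (A : Subset n) e → lookup (A ⊕ e) e ≡ true
  lookup-⊕ A e = lookup∘updateAt e A

  ∁-⊖ : ∀ {n} (U : Subset n) e → lookup U e ≡ true → ∁ (U ⊖ e) ⊖ e ≡ ∁ U
  ∁-⊖ (true ∷ U) zero    _ = refl
  ∁-⊖ (u ∷ U)    (suc e) e∈U = cong (_ ∷_) (∁-⊖ U e e∈U)

  private
    ΣS-flip₁ : ∀ {n} (e : Fin n) (h : Subset n → ℕ) →
      ΣS (λ A → χ (not (lookup A e)) * h A) ≡ ΣS (λ U → χ (lookup U e) * h (U ⊖ e))
    ΣS-flip₁ {suc n} zero h = +-comm (ΣS (λ A → 1 * h (outside ∷ A))) _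
    ΣS-flip₁ {suc n} (suc e) h = cong₂ _+_ (ΣS-flip₁ e _) (ΣS-flip₁ e _)

  -- Every edge A ⊂ A ∪ {e} of the cube is seen once from below and once from above. Both the
  -- passage along chains and the double counting of bad elements rest on this.
  ΣS-flip : ∀ {n} (h : Subset n → Fin n → ℕ) →
    ΣS (λ A → sum λ e → χ (not (lookup A e)) * h A e) ≡
    ΣS (λ U → sum λ e → χ (lookup U e) * h (U ⊖ e) e)
  ΣS-flip h = trans (ΣS-sum-comm (λ A e → χ (not (lookup A e)) * h A e))
    (trans (sum-cong-≗ (λ e → ΣS-flip₁ e (λ A → h A e)))
    (sym (ΣS-sum-comm (λ U e → χ (lookup U e) * h (U ⊖ e) e))))

  ∣⊖∣ : ∀ {n} (E : Subset n) e → lookup E e ≡ true → ∣ E ∣ ≡ suc ∣ E ⊖ e ∣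
  ∣⊖∣ (true ∷ E)  zero    _   = refl
  ∣⊖∣ (true ∷ E)  (suc e) e∈E = cong suc (∣⊖∣ E e e∈E)
  ∣⊖∣ (false ∷ E) (suc e) e∈E = ∣⊖∣ E e e∈E

  -- Sums `Φ` over the sequences of `k` distinct elements of `E`. As an iterated sum it exposes the
  -- first element, which is what the inductions split off, and no list of orderings is formed;
  -- `Arr` supplies membership when a pointwise estimate needs it.
  arr : ∀ {n} → ℕ → Subset n → (List (Fin n) → ℕ) → ℕ
  arr zero    E Φ = Φ []
  arr (suc k) E Φ = sum λ e → χ (lookup E e) * arr k (E ⊖ e) (Φ ∘ (e ∷_))

  data Arr {n} : ℕ → Subset n → List (Fin n) → Set where
    []  : ∀ {E} → Arr zero E []
    _∷_ : ∀ {k E e π} → lookup E e ≡ true → Arr k (E ⊖ e) π → Arr (suc k) E (e ∷ π)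

  module _ {n : ℕ} where

    arr-mono : ∀ k (E : Subset n) {Φ Ψ} → (∀ π → Arr k E π → Φ π ≤ Ψ π) → arr k E Φ ≤ arr k E Ψ
    arr-mono zero    E Φ≤Ψ = Φ≤Ψ [] []
    arr-mono (suc k) E Φ≤Ψ = sum-mono λ e → χ-mono (lookup E e) λ e∈E →
      arr-mono k (E ⊖ e) λ π p → Φ≤Ψ (e ∷ π) (e∈E ∷ p)

    arr-cong : ∀ k (E : Subset n) {Φ Ψ} → (∀ π → Φ π ≡ Ψ π) → arr k E Φ ≡ arr k E Ψ
    arr-cong k E Φ≡Ψ = ≤-antisym (arr-mono k E λ π _ → ≤-reflexive (Φ≡Ψ π))
      (arr-mono k E λ π _ → ≤-reflexive (sym (Φ≡Ψ π)))

    arr-+ : ∀ k (E : Subset n) Φ Ψ → arr k E (λ π → Φ π + Ψ π) ≡ arr k E Φ + arr k E Ψ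
    arr-+ zero    E Φ Ψ = refl
    arr-+ (suc k) E Φ Ψ = trans
      (sum-cong-≗ λ e → trans (cong (χ (lookup E e) *_) (arr-+ k (E ⊖ e) _ _)) (*-distribˡ-+ (χ (lookup E e)) _ _))
      (∑-distrib-+ (λ e → χ (lookup E e) * arr k (E ⊖ e) (Φ ∘ (e ∷_))) _)

    arr-* : ∀ k (E : Subset n) c Φ → arr k E (λ π → c * Φ π) ≡ c * arr k E Φ
    arr-* zero    E c Φ = refl
    arr-* (suc k) E c Φ = trans
      (sum-cong-≗ λ e → trans (cong (χ (lookup E e) *_) (arr-* k (E ⊖ e) c _)) (*-left-comm (χ (lookup E e)) c _))
      (sym (*-distribˡ-sum c (λ e → χ (lookup E e) * arr k (E ⊖ e) (Φ ∘ (e ∷_)))))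

    arr-0 : ∀ k (E : Subset n) → arr k E (const 0) ≡ 0
    arr-0 k E = arr-* k E 0 (const 0)

    arr-sum : ∀ k (E : Subset n) {m} (Φ : Fin m → List (Fin n) → ℕ) →
      arr k E (λ π → sum λ i → Φ i π) ≡ sum λ i → arr k E (Φ i)
    arr-sum k E {zero}  Φ = arr-0 k E
    arr-sum k E {suc m} Φ = trans (arr-+ k E (Φ zero) _) (cong (arr k E (Φ zero) +_) (arr-sum k E (Φ ∘ suc)))

    -- The first and the last element can be chosen in either order: the double sum over both is
    -- symmetric because removals commute.
    arr-snoc : ∀ k (E : Subset n) Φ →
      arr (suc k) E Φ ≡ sum λ e → χ (lookup E e) * arr k (E ⊖ e) (Φ ∘ (_∷ʳ e))
    arr-snoc zero    E Φ = refl
    arr-snoc (suc k) E Φ = begin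
      sum (λ e → χ (lookup E e) * arr (suc k) (E ⊖ e) (Φ ∘ (e ∷_)))
        ≡⟨ sum-cong-≗ (λ e → trans (cong (χ (lookup E e) *_) (arr-snoc k (E ⊖ e) (Φ ∘ (e ∷_)))) (*-distribˡ-sum (χ (lookup E e)) (λ f → χ (lookup (E ⊖ e) f) * arr k (E ⊖ e ⊖ f) (λ π → Φ (e ∷ π ∷ʳ f))))) ⟩
      sum (λ e → sum λ f → χ (lookup E e) * (χ (lookup (E ⊖ e) f) * arr k (E ⊖ e ⊖ f) (λ π → Φ (e ∷ π ∷ʳ f))))
        ≡⟨ ∑-comm (λ e f → χ (lookup E e) * (χ (lookup (E ⊖ e) f) * arr k (E ⊖ e ⊖ f) (λ π → Φ (e ∷ π ∷ʳ f)))) ⟩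
      sum (λ f → sum λ e → χ (lookup E e) * (χ (lookup (E ⊖ e) f) * arr k (E ⊖ e ⊖ f) (λ π → Φ (e ∷ π ∷ʳ f))))
        ≡⟨ sum-cong-≗ (λ f → sum-cong-≗ (λ e → swap e f (λ π → Φ (e ∷ π ∷ʳ f)))) ⟩
      sum (λ f → sum λ e → χ (lookup E f) * (χ (lookup (E ⊖ f) e) * arr k (E ⊖ f ⊖ e) (λ π → Φ (e ∷ π ∷ʳ f))))
        ≡⟨ sum-cong-≗ (λ f → *-distribˡ-sum (χ (lookup E f)) (λ e → χ (lookup (E ⊖ f) e) * arr k (E ⊖ f ⊖ e) (λ π → Φ (e ∷ π ∷ʳ f)))) ⟨
      sum (λ f → χ (lookup E f) * arr (suc k) (E ⊖ f) (Φ ∘ (_∷ʳ f))) ∎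
      where
      open ≡-Reasoning
      swap : ∀ e f (Ψ : List (Fin n) → ℕ) →
        χ (lookup E e) * (χ (lookup (E ⊖ e) f) * arr k (E ⊖ e ⊖ f) Ψ) ≡
        χ (lookup E f) * (χ (lookup (E ⊖ f) e) * arr k (E ⊖ f ⊖ e) Ψ)
      swap e f Ψ with e Fin.≟ f
      ... | yes refl = refl
      ... | no  e≢f  rewrite lookup∘updateAt′ f e {const outside} (e≢f ∘ sym) E | lookup∘updateAt′ e f {const outside} e≢f E
                           | []≔-commutes {x = outside} {y = outside} E e f e≢f =
        *-left-comm (χ (lookup E e)) (χ (lookup E f)) _

    -- Reconciles two directions of reading: the lists in a flag begin next to the marked set,
    -- whereas the ballot theorem tests suffixes.
    arr-reverse : ∀ k (E : Subset n) Φ → arr k E (Φ ∘ reverse) ≡ arr k E Φ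
    arr-reverse zero    E Φ = refl
    arr-reverse (suc k) E Φ = trans
      (sum-cong-≗ λ e → cong (χ (lookup E e) *_)
        (trans (arr-cong k (E ⊖ e) λ π → cong Φ (unfold-reverse e π)) (arr-reverse k (E ⊖ e) (Φ ∘ (_∷ʳ e)))))
      (sym (arr-snoc k E Φ))

    perm : Subset n → (List (Fin n) → ℕ) → ℕ
    perm E = arr ∣ E ∣ E

    private
      perm-step-aux : ∀ k (E : Subset n) Φ → ∣ E ∣ ≡ k →
        arr k E Φ ≡ χ (k ≡ᵇ 0) * Φ [] + sum λ e → χ (lookup E e) * perm (E ⊖ e) (Φ ∘ (e ∷_))
      perm-step-aux zero E Φ ∣E∣≡0 = sym (trans
        (cong₂ _+_ (*-identityˡ _) (trans (sum-cong-≗ λ e → χ-cong (lookup E e) {y = 0} λ e∈E →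
          contradiction (trans (sym ∣E∣≡0) (∣⊖∣ E e e∈E)) λ ())
          (trans (sum-cong-≗ λ e → *-zeroʳ (χ (lookup E e))) (sum-replicate-zero n))))
        (+-identityʳ _))
      perm-step-aux (suc k) E Φ ∣E∣≡1+k = sum-cong-≗ λ e → χ-cong (lookup E e) λ e∈E →
        cong (λ l → arr l (E ⊖ e) (Φ ∘ (e ∷_))) (suc-injective (trans (sym ∣E∣≡1+k) (∣⊖∣ E e e∈E)))

    -- Stated without a case split on `∣ E ∣`, so that it can be summed over all sets; the empty set
    -- becomes an indicator term.
    perm-step : ∀ (E : Subset n) Φ →
      perm E Φ ≡ χ (∣ E ∣ ≡ᵇ 0) * Φ [] + sum λ e → χ (lookup E e) * perm (E ⊖ e) (Φ ∘ (e ∷_))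
    perm-step E Φ = perm-step-aux ∣ E ∣ E Φ refl

  -- Maximal chains

  private
    x+[y+z]≡y+[x+z] : ∀ x y z → x + (y + z) ≡ y + (x + z)
    x+[y+z]≡y+[x+z] = solve-∀

  ∣∣-sum : ∀ {n} (E : Subset n) → ∣ E ∣ ≡ sum λ e → χ (lookup E e)
  ∣∣-sum []          = refl
  ∣∣-sum (true ∷ E)  = cong suc (∣∣-sum E)
  ∣∣-sum (false ∷ E) = ∣∣-sum E

  wt : ∀ {n} → (Fin n → Bool) → Subset n → ℕ
  wt D E = sum λ e → χ (lookup E e) * χ (D e)

  wt-⊖ : ∀ {n} D (E : Subset n) e → lookup E e ≡ true → wt D E ≡ χ (D e) + wt D (E ⊖ e)
  wt-⊖ D (true ∷ E) zero    _   = cong (_+ wt (D ∘ suc) E) (*-identityˡ (χ (D zero)))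
  wt-⊖ D (x ∷ E)    (suc e) e∈E = trans
    (cong (χ x * χ (D zero) +_) (wt-⊖ (D ∘ suc) E e e∈E))
    (x+[y+z]≡y+[x+z] (χ x * χ (D zero)) (χ (D (suc e))) _)

  wt-∅ : ∀ {n} D (E : Subset n) → ∣ E ∣ ≡ 0 → wt D E ≡ 0
  wt-∅ D []          _     = refl
  wt-∅ D (false ∷ E) ∣E∣≡0 = wt-∅ (D ∘ suc) E ∣E∣≡0

  cnt : ∀ {n} → (Fin n → Bool) → List (Fin n) → ℕ
  cnt D []      = 0
  cnt D (x ∷ π) = χ (D x) + cnt D π

  Arr-length : ∀ {n k} {E : Subset n} {π} → Arr k E π → length π ≡ k
  Arr-length []      = refl
  Arr-length (_ ∷ p) = cong suc (Arr-length p)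

  Arr-cnt : ∀ {n k} {E : Subset n} {π} D → Arr k E π → ∣ E ∣ ≡ k → cnt D π ≡ wt D E
  Arr-cnt {E = E} D [] ∣E∣≡0 = sym (wt-∅ D E ∣E∣≡0)
  Arr-cnt {E = E} D (_∷_ {e = e} e∈E p) ∣E∣≡k = trans
    (cong (χ (D e) +_) (Arr-cnt D p (suc-injective (trans (sym (∣⊖∣ E e e∈E)) ∣E∣≡k))))
    (sym (wt-⊖ D E e e∈E))

  arr-1 : ∀ {n} k (E : Subset n) → ∣ E ∣ ≡ k → arr k E (const 1) ≡ k !
  arr-1 zero    E _     = refl
  arr-1 (suc k) E ∣E∣≡k = begin
    sum (λ e → χ (lookup E e) * arr k (E ⊖ e) (const 1))
      ≡⟨ sum-cong-≗ (λ e → χ-cong (lookup E e) λ e∈E → arr-1 k (E ⊖ e) (suc-injective (trans (sym (∣⊖∣ E e e∈E)) ∣E∣≡k))) ⟩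
    sum (λ e → χ (lookup E e) * k !) ≡⟨ *-distribʳ-sum (k !) (λ e → χ (lookup E e)) ⟨
    sum (λ e → χ (lookup E e)) * k ! ≡⟨ cong (_* k !) (trans (sym (∣∣-sum E)) ∣E∣≡k) ⟩
    suc k ! ∎
    where open ≡-Reasoning

  overfull : ∀ {n} → ℕ → (Fin n → Bool) → List (Fin n) → Bool
  overfull M D []      = false
  overfull M D (x ∷ π) = (length (x ∷ π) ≤ᵇ M * cnt D (x ∷ π)) ∨ overfull M D π

  private
    -- Each element of `D` in `E` survives all removals but its own, that is, `i` of the `suc i`.
    sum-wt-⊖ : ∀ {n} D (E : Subset n) i → ∣ E ∣ ≡ suc i →
      sum (λ e → χ (lookup E e) * wt D (E ⊖ e)) ≡ i * wt D E
    sum-wt-⊖ D E i ∣E∣≡ = +-cancelˡ-≡ (wt D E) _ _ (begin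
      wt D E + sum (λ e → χ (lookup E e) * wt D (E ⊖ e))
        ≡⟨ ∑-distrib-+ (λ e → χ (lookup E e) * χ (D e)) _ ⟨
      sum (λ e → χ (lookup E e) * χ (D e) + χ (lookup E e) * wt D (E ⊖ e))
        ≡⟨ sum-cong-≗ (λ e → trans (sym (*-distribˡ-+ (χ (lookup E e)) (χ (D e)) _))
             (χ-cong (lookup E e) (λ e∈E → sym (wt-⊖ D E e e∈E)))) ⟩
      sum (λ e → χ (lookup E e) * wt D E) ≡⟨ *-distribʳ-sum (wt D E) (λ e → χ (lookup E e)) ⟨
      sum (λ e → χ (lookup E e)) * wt D E ≡⟨ cong (_* wt D E) (trans (sym (∣∣-sum E)) ∣E∣≡) ⟩
      wt D E + i * wt D E ∎)
      where open ≡-Reasoning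

    regroup : ∀ a M w f → a * (M * w * f) ≡ M * f * (a * w)
    regroup = solve-∀

    regroup′ : ∀ i M w f → M * f * (i * w) ≡ M * w * (i * f)
    regroup′ = solve-∀

  -- The ballot theorem. Only suffixes are tested, so the first element can be split off.
  overfull-bound : ∀ {n} M D k (E : Subset n) → ∣ E ∣ ≡ k →
    arr k E (χ ∘ overfull M D) ≤ M * wt D E * pred k !
  overfull-bound M D zero    E _ = z≤n
  -- The list as a whole contains `wt D E` elements of `D` in whatever order, so its own test has
  -- the same outcome for all orderings. If it succeeds, the bound is at least the number of
  -- orderings; if it fails, only the tail matters and the induction hypothesis is averaged over the
  -- first element.
  overfull-bound M D (suc j) E ∣E∣≡ with suc j ≤ᵇ M * wt D E in eq
  ... | true  = begin
    arr (suc j) E (χ ∘ overfull M D) ≤⟨ arr-mono (suc j) E (λ π _ → χ≤1 (overfull M D π)) ⟩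
    arr (suc j) E (const 1)     ≡⟨ arr-1 (suc j) E ∣E∣≡ ⟩
    suc j * j !                 ≤⟨ *-monoˡ-≤ (j !) (≤ᵇ⇒≤ (suc j) (M * wt D E) (subst T (sym eq) _)) ⟩
    M * wt D E * j !            ∎
    where open ≤-Reasoning
  ... | false = begin
    sum (λ e → χ (lookup E e) * arr j (E ⊖ e) (λ π → χ (overfull M D (e ∷ π))))
      ≤⟨ sum-mono (λ e → χ-mono (lookup E e) (λ e∈E → ≤-trans
           (arr-mono j (E ⊖ e) (λ π p → ≤-reflexive (cong χ (tail-exc e∈E p))))
           (overfull-bound M D j (E ⊖ e) (suc-injective (trans (sym (∣⊖∣ E e e∈E)) ∣E∣≡))))) ⟩
    sum (λ e → χ (lookup E e) * (M * wt D (E ⊖ e) * pred j !))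
      ≡⟨ sum-cong-≗ (λ e → regroup (χ (lookup E e)) M (wt D (E ⊖ e)) (pred j !)) ⟩
    sum (λ e → M * pred j ! * (χ (lookup E e) * wt D (E ⊖ e)))
      ≡⟨ *-distribˡ-sum (M * pred j !) (λ e → χ (lookup E e) * wt D (E ⊖ e)) ⟨
    M * pred j ! * sum (λ e → χ (lookup E e) * wt D (E ⊖ e))
      ≡⟨ cong (M * pred j ! *_) (sum-wt-⊖ D E j ∣E∣≡) ⟩
    M * pred j ! * (j * wt D E) ≡⟨ regroup′ j M (wt D E) (pred j !) ⟩
    M * wt D E * (j * pred j !) ≤⟨ *-monoʳ-≤ (M * wt D E) (j*[j-1]!≤j! j) ⟩
    M * wt D E * j ! ∎
    where
    open ≤-Reasoning
    j*[j-1]!≤j! : ∀ j → j * pred j ! ≤ j !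
    j*[j-1]!≤j! zero    = z≤n
    j*[j-1]!≤j! (suc j) = ≤-refl
    tail-exc : ∀ {e π} → lookup E e ≡ true → Arr j (E ⊖ e) π → overfull M D (e ∷ π) ≡ overfull M D π
    tail-exc {e} {π} e∈E p rewrite Arr-length p | Arr-cnt D (e∈E ∷ p) ∣E∣≡ | eq = refl

  -- Σflags Ψ sums over maximal chains of subsets with a marked member A: ρ lists the elements of A
  -- from the last added to the first, σ the remaining ones in the order in which they are added.
  State : ℕ → Set
  State n = Subset n → List (Fin n) → List (Fin n) → ℕ

  Σflags : ∀ {n} → State n → ℕ
  Σflags Ψ = ΣS λ A → perm A λ ρ → perm (∁ A) (Ψ A ρ)

  -- Evaluates `Ψ` after the mark has moved `k` steps up the same chain; positions beyond the full
  -- set count 0.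
  at : ∀ {n} → ℕ → State n → State n
  at zero    Ψ = Ψ
  at (suc k) Ψ A ρ []      = 0
  at (suc k) Ψ A ρ (e ∷ σ) = at k Ψ (A ⊕ e) (e ∷ ρ) σ

  private
    Σflags-mono : ∀ {n} {Φ Ψ : State n} →
      (∀ A ρ σ → Arr ∣ A ∣ A ρ → Arr ∣ ∁ A ∣ (∁ A) σ → Φ A ρ σ ≤ Ψ A ρ σ) → Σflags Φ ≤ Σflags Ψ
    Σflags-mono Φ≤Ψ = ΣS-mono λ A → arr-mono ∣ A ∣ A λ ρ p → arr-mono ∣ ∁ A ∣ (∁ A) λ σ → Φ≤Ψ A ρ σ p

    Σflags-cong : ∀ {n} {Φ Ψ : State n} → (∀ A ρ σ → Φ A ρ σ ≡ Ψ A ρ σ) → Σflags Φ ≡ Σflags Ψ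
    Σflags-cong Φ≡Ψ = ≤-antisym (Σflags-mono λ A ρ σ _ _ → ≤-reflexive (Φ≡Ψ A ρ σ))
      (Σflags-mono λ A ρ σ _ _ → ≤-reflexive (sym (Φ≡Ψ A ρ σ)))

    ΣS-0 : ∀ {n} → ΣS {n} (const 0) ≡ 0
    ΣS-0 {n} = sym (*-distribˡ-ΣS {n} 0 (const 0))

    ΣS-∅ : ∀ {n} (g : Subset n → ℕ) → ΣS (λ U → χ (∣ U ∣ ≡ᵇ 0) * g U) ≡ g ∅
    ΣS-∅ {zero}  g = *-identityˡ _
    ΣS-∅ {suc n} g = trans (cong₂ _+_ (ΣS-∅ (g ∘ (outside ∷_))) (ΣS-0 {n})) (+-identityʳ _)

    ∁∅ : ∀ {n} → ∁ (∅ {n}) ≡ full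
    ∁∅ {zero}  = refl
    ∁∅ {suc n} = cong (true ∷_) ∁∅

    -- A flag with nonempty marked set arises from exactly one flag marked a step lower, the head of
    -- `ρ` going back to `σ`. So `at 1` misses only the flags marked at `∅`.
    Σflags-step : ∀ {n} (Ψ : State n) → Σflags Ψ ≡ perm full (Ψ ∅ []) + Σflags (at 1 Ψ)
    Σflags-step {n} Ψ = begin
      Σflags Ψ
        ≡⟨ ΣS-cong (λ U → perm-step U (λ ρ → perm (∁ U) (Ψ U ρ))) ⟩
      ΣS (λ U → χ (∣ U ∣ ≡ᵇ 0) * perm (∁ U) (Ψ U []) + sum λ e → χ (lookup U e) * h′ U e)
        ≡⟨ ΣS-distrib-+ (λ U → χ (∣ U ∣ ≡ᵇ 0) * perm (∁ U) (Ψ U [])) _ ⟩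
      ΣS (λ U → χ (∣ U ∣ ≡ᵇ 0) * perm (∁ U) (Ψ U [])) + ΣS (λ U → sum λ e → χ (lookup U e) * h′ U e)
        ≡⟨ cong₂ _+_ (trans (ΣS-∅ (λ U → perm (∁ U) (Ψ U []))) (cong (λ E → perm E (Ψ ∅ [])) ∁∅))
             (ΣS-cong λ U → sum-cong-≗ λ e → χ-cong (lookup U e) (sym ∘ h-⊖ U e)) ⟩
      perm full (Ψ ∅ []) + ΣS (λ U → sum λ e → χ (lookup U e) * h (U ⊖ e) e)
        ≡⟨ cong (perm full (Ψ ∅ []) +_) (ΣS-flip h) ⟨
      perm full (Ψ ∅ []) + ΣS (λ A → sum λ e → χ (not (lookup A e)) * h A e)
        ≡⟨ cong (perm full (Ψ ∅ []) +_) (ΣS-cong shifted) ⟨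
      perm full (Ψ ∅ []) + Σflags (at 1 Ψ) ∎
      where
      open ≡-Reasoning
      h h′ : Subset n → Fin n → ℕ
      h  A e = perm A λ ρ → perm (∁ A ⊖ e) (Ψ (A ⊕ e) (e ∷ ρ))
      h′ U e = perm (U ⊖ e) λ ρ → perm (∁ U) (Ψ U (e ∷ ρ))
      h-⊖ : ∀ U e → lookup U e ≡ true → h (U ⊖ e) e ≡ h′ U e
      h-⊖ U e e∈U rewrite ∁-⊖ U e e∈U | ⊖-⊕ U e e∈U = refl
      shifted : ∀ A → perm A (λ ρ → perm (∁ A) (at 1 Ψ A ρ)) ≡ sum λ e → χ (not (lookup A e)) * h A e
      shifted A = begin
        perm A (λ ρ → perm (∁ A) (at 1 Ψ A ρ))
          ≡⟨ arr-cong ∣ A ∣ A (λ ρ → trans (perm-step (∁ A) (at 1 Ψ A ρ))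
               (cong (_+ sum λ e → χ (lookup (∁ A) e) * perm (∁ A ⊖ e) (Ψ (A ⊕ e) (e ∷ ρ))) (*-zeroʳ (χ (∣ ∁ A ∣ ≡ᵇ 0))))) ⟩
        perm A (λ ρ → sum λ e → χ (lookup (∁ A) e) * perm (∁ A ⊖ e) (Ψ (A ⊕ e) (e ∷ ρ)))
          ≡⟨ arr-sum ∣ A ∣ A (λ e ρ → χ (lookup (∁ A) e) * perm (∁ A ⊖ e) (Ψ (A ⊕ e) (e ∷ ρ))) ⟩
        sum (λ e → perm A (λ ρ → χ (lookup (∁ A) e) * perm (∁ A ⊖ e) (Ψ (A ⊕ e) (e ∷ ρ))))
          ≡⟨ sum-cong-≗ (λ e → trans (arr-* ∣ A ∣ A (χ (lookup (∁ A) e)) _)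
               (cong (λ b → χ b * h A e) (lookup-map e not A))) ⟩
        sum (λ e → χ (not (lookup A e)) * h A e) ∎

    at-shift : ∀ {n} k (Ψ : State n) A ρ σ → at k (at 1 Ψ) A ρ σ ≡ at (suc k) Ψ A ρ σ
    at-shift zero    Ψ A ρ σ       = refl
    at-shift (suc k) Ψ A ρ []      = refl
    at-shift (suc k) Ψ A ρ (e ∷ σ) = at-shift k Ψ (A ⊕ e) (e ∷ ρ) σ

    at-beyond : ∀ {n} k (Ψ : State n) A ρ σ → length σ < k → at k Ψ A ρ σ ≡ 0
    at-beyond (suc k) Ψ A ρ []      _         = refl
    at-beyond (suc k) Ψ A ρ (e ∷ σ) (s≤s σ<k) = at-beyond k Ψ (A ⊕ e) (e ∷ ρ) σ σ<k

    Σflags-steps : ∀ {n} N (Ψ : State n) →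
      Σflags Ψ ≡ sum {N} (λ i → perm full (at (toℕ i) Ψ ∅ [])) + Σflags (at N Ψ)
    Σflags-steps zero    Ψ = refl
    Σflags-steps {n} (suc N) Ψ = begin
      Σflags Ψ ≡⟨ Σflags-step Ψ ⟩
      perm full (Ψ ∅ []) + Σflags (at 1 Ψ)
        ≡⟨ cong (perm full (Ψ ∅ []) +_) (Σflags-steps N (at 1 Ψ)) ⟩
      perm full (Ψ ∅ []) + (sum {N} (λ i → perm full (at (toℕ i) (at 1 Ψ) ∅ [])) + Σflags (at N (at 1 Ψ)))
        ≡⟨ cong (perm full (Ψ ∅ []) +_) (cong₂ _+_
             (sum-cong-≗ {N} λ i → arr-cong ∣ full {n} ∣ full (at-shift (toℕ i) Ψ ∅ []))
             (Σflags-cong (at-shift N Ψ))) ⟩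
      perm full (Ψ ∅ []) + (sum {N} (λ i → perm full (at (suc (toℕ i)) Ψ ∅ [])) + Σflags (at (suc N) Ψ))
        ≡⟨ +-assoc (perm full (Ψ ∅ [])) _ _ ⟨
      sum {suc N} (λ i → perm full (at (toℕ i) Ψ ∅ [])) + Σflags (at (suc N) Ψ) ∎
      where open ≡-Reasoning

  -- Regroups the flags by their maximal chain: there are `n !` chains with positions 0 to n each,
  -- and after `suc n` steps the remaining sum lies beyond the top. This is the chain-counting half
  -- of the LYM inequality.
  Σflags-bound : ∀ {n} (Ψ : State n) R →
    (∀ π → Arr ∣ full {n} ∣ full π → sum {suc n} (λ i → at (toℕ i) Ψ ∅ [] π) ≤ R) → Σflags Ψ ≤ R * n !
  Σflags-bound {n} Ψ R hits≤R = begin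
    Σflags Ψ ≡⟨ Σflags-steps (suc n) Ψ ⟩
    sum {suc n} (λ i → perm full (at (toℕ i) Ψ ∅ [])) + Σflags (at (suc n) Ψ)
      ≡⟨ cong₂ _+_ (sym (arr-sum ∣ full {n} ∣ full {suc n} (λ i → at (toℕ i) Ψ ∅ []))) beyond ⟩
    perm full (λ π → sum {suc n} λ i → at (toℕ i) Ψ ∅ [] π) + 0 ≡⟨ +-identityʳ _ ⟩
    perm full (λ π → sum {suc n} λ i → at (toℕ i) Ψ ∅ [] π)
      ≤⟨ arr-mono ∣ full {n} ∣ full (λ π p → ≤-trans (hits≤R π p) (≤-reflexive (sym (*-identityʳ R)))) ⟩
    perm (full {n}) (λ π → R * 1) ≡⟨ arr-* ∣ full {n} ∣ full R (const 1) ⟩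
    R * perm (full {n}) (const 1) ≡⟨ cong (R *_) (arr-1 ∣ full {n} ∣ full refl) ⟩
    R * ∣ full {n} ∣ !            ≡⟨ cong (λ k → R * k !) (∣⊤∣≡n n) ⟩
    R * n ! ∎
    where
    open ≤-Reasoning
    beyond : Σflags (at (suc n) Ψ) ≡ 0
    beyond = n≤0⇒n≡0 (begin
      Σflags (at (suc n) Ψ)
        ≤⟨ Σflags-mono {Φ = at (suc n) Ψ} {Ψ = λ _ _ _ → 0} (λ A ρ σ _ p → ≤-reflexive
             (at-beyond (suc n) Ψ A ρ σ (s≤s (≤-trans (≤-reflexive (Arr-length p)) (∣p∣≤n (∁ A)))))) ⟩
      Σflags {n} (λ _ _ _ → 0)
        ≡⟨ ΣS-cong {n} (λ A → trans (arr-cong ∣ A ∣ A (λ ρ → arr-0 ∣ ∁ A ∣ (∁ A))) (arr-0 ∣ A ∣ A)) ⟩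
      ΣS {n} (const 0) ≡⟨ ΣS-0 {n} ⟩
      0 ∎)

  private
    sum-below : ∀ N R (g : ℕ → ℕ) → (∀ i → g i ≤ 1) → (∀ i → R ≤ i → g i ≡ 0) → sum {N} (g ∘ toℕ) ≤ R
    sum-below zero    R       g g≤1 g≡0 = z≤n
    sum-below (suc N) zero    g g≤1 g≡0 rewrite g≡0 0 z≤n = sum-below N 0 (g ∘ suc) (g≤1 ∘ suc) (λ i _ → g≡0 (suc i) z≤n)
    sum-below (suc N) (suc R) g g≤1 g≡0 = +-mono-≤ (g≤1 0) (sum-below N R (g ∘ suc) (g≤1 ∘ suc) (λ i → g≡0 (suc i) ∘ s≤s))

  -- From the first index with a nonzero value onwards, only the next `R` indices can contribute.
  sum-clustered : ∀ N R (g : ℕ → ℕ) → (∀ i → g i ≤ 1) →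
    (∀ i s → g i ≢ 0 → g (i + s) ≢ 0 → s < R) → sum {N} (g ∘ toℕ) ≤ R
  sum-clustered zero    R g g≤1 close = z≤n
  sum-clustered (suc N) R g g≤1 close with g 0 ≟ 0
  ... | yes g0≡0 rewrite g0≡0 = sum-clustered N R (g ∘ suc) (g≤1 ∘ suc) (λ i → close (suc i))
  ... | no  g0≢0 = sum-below (suc N) R g g≤1 far
    where
    far : ∀ i → R ≤ i → g i ≡ 0
    far i R≤i with g i ≟ 0
    ... | yes gi≡0 = gi≡0
    ... | no  gi≢0 = contradiction (close 0 i g0≢0 gi≢0) (≤⇒≯ R≤i)

  -- Exchange of elements and copies of the standard example

  ∈-⊕⁻ : ∀ {n} {A : Subset n} {e x} → x ∈ A ⊕ e → x ≡ e ⊎ x ∈ A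
  ∈-⊕⁻ {A = A} {e} {x} x∈ with x Fin.≟ e
  ... | yes x≡e = inj₁ x≡e
  ... | no  x≢e = inj₂ (lookup⇒[]= x A (trans (sym (lookup∘updateAt′ x e x≢e A)) ([]=⇒lookup x∈)))

  ∈-⊕⁺ : ∀ {n} {A : Subset n} {e x} → x ∈ A → x ∈ A ⊕ e
  ∈-⊕⁺ {A = A} {e} {x} x∈A with x Fin.≟ e
  ... | yes refl = []≔-updates A x
  ... | no  x≢e  = []≔-minimal A x e x≢e x∈A

  ∈-⊖⁺ : ∀ {n} {A : Subset n} {e x} → x ∈ A → x ≢ e → x ∈ A ⊖ e
  ∈-⊖⁺ {A = A} {e} {x} x∈A x≢e = []≔-minimal A x e x≢e x∈A

  ∈-⊖⁻ : ∀ {n} {A : Subset n} {e x} → x ∈ A ⊖ e → x ≢ e × x ∈ A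
  ∈-⊖⁻ {A = A} {e} {x} x∈ with x Fin.≟ e
  ... | yes refl = contradiction (trans (sym ([]=⇒lookup x∈)) (lookup-⊖ A x)) λ ()
  ... | no  x≢e  = x≢e , lookup⇒[]= x A (trans (sym (lookup∘updateAt′ x e x≢e A)) ([]=⇒lookup x∈))

  infixl 7 _⊕*_
  _⊕*_ : ∀ {n} → Subset n → List (Fin n) → Subset n
  _⊕*_ = foldl _⊕_

  ∈-⊕*⁻ : ∀ {n} {A : Subset n} τ {x} → x ∈ A ⊕* τ → x ∈ A ⊎ x L.∈ τ
  ∈-⊕*⁻ []      x∈ = inj₁ x∈
  ∈-⊕*⁻ (e ∷ τ) x∈ with ∈-⊕*⁻ τ x∈
  ... | inj₂ x∈τ  = inj₂ (there x∈τ)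
  ... | inj₁ x∈′ with ∈-⊕⁻ x∈′
  ...   | inj₁ x≡e = inj₂ (here x≡e)
  ...   | inj₂ x∈A = inj₁ x∈A

  ∈-⊕*⁺ˡ : ∀ {n} {A : Subset n} τ {x} → x ∈ A → x ∈ A ⊕* τ
  ∈-⊕*⁺ˡ []      x∈A = x∈A
  ∈-⊕*⁺ˡ (e ∷ τ) x∈A = ∈-⊕*⁺ˡ τ (∈-⊕⁺ x∈A)

  ∈-⊕*⁺ʳ : ∀ {n} {A : Subset n} τ {x} → x L.∈ τ → x ∈ A ⊕* τ
  ∈-⊕*⁺ʳ {A = A} (e ∷ τ) (here refl) = ∈-⊕*⁺ˡ τ ([]≔-updates A e)
  ∈-⊕*⁺ʳ (e ∷ τ) (there x∈τ) = ∈-⊕*⁺ʳ τ x∈τ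

  Arr-Unique : ∀ {n k} {E : Subset n} {π} → Arr k E π → Unique π
  Arr-Unique []        = []
  Arr-Unique (_∷_ {E = E} {e = e} e∈E p) = All.tabulate fresh ∷ Arr-Unique p
    where
    Arr-∈ : ∀ {k E π x} → Arr k E π → x L.∈ π → x ∈ E
    Arr-∈ (_∷_ {E = E} {e = e} e∈E p) (here refl) = lookup⇒[]= e E e∈E
    Arr-∈ (e∈E ∷ p) (there x∈π)  = proj₂ (∈-⊖⁻ (Arr-∈ p x∈π))
    fresh : ∀ {x} → x L.∈ _ → e ≢ x
    fresh x∈π e≡x = proj₁ (∈-⊖⁻ (Arr-∈ p x∈π)) (sym e≡x)

  Unique-++ˡʳ : ∀ {a} {A : Set a} (xs : List A) {ys x} → Unique (xs ++ ys) → x L.∈ xs → ¬ x L.∈ ys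
  Unique-++ˡʳ (x ∷ xs) (x∉ ∷ u) (here refl) x∈ys = All.lookup x∉ (∈-++⁺ʳ xs x∈ys) refl
  Unique-++ˡʳ (x ∷ xs) (x∉ ∷ u) (there x∈xs) x∈ys = Unique-++ˡʳ xs u x∈xs x∈ys

  Unique-lookup-injective : ∀ {a} {A : Set a} {xs : List A} → Unique xs → ∀ i j → List.lookup xs i ≡ List.lookup xs j → i ≡ j
  Unique-lookup-injective (x∉ ∷ u) zero    zero    _  = refl
  Unique-lookup-injective (x∉ ∷ u) zero    (suc j) eq = contradiction eq (All.lookup x∉ (∈-lookup j))
  Unique-lookup-injective (x∉ ∷ u) (suc i) zero    eq = contradiction (sym eq) (All.lookup x∉ (∈-lookup i))
  Unique-lookup-injective (x∉ ∷ u) (suc i) (suc j) eq = cong suc (Unique-lookup-injective u i j eq)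

  cnt-ʳ++ : ∀ {n} (D : Fin n → Bool) xs {ys} → cnt D (xs ʳ++ ys) ≡ cnt D xs + cnt D ys
  cnt-ʳ++ D []       = refl
  cnt-ʳ++ D (x ∷ xs) {ys} = trans (cnt-ʳ++ D xs) (move (cnt D xs) (χ (D x)) (cnt D ys))
    where
    move : ∀ a b c → a + (b + c) ≡ b + a + c
    move = solve-∀

  ¬overfull⇒few : ∀ {n} M D (α β : List (Fin n)) → overfull M D (α ++ β) ≡ false → β ≢ [] → M * cnt D β < length β
  ¬overfull⇒few M D [] []      _  β≢[] = contradiction refl β≢[]
  ¬overfull⇒few M D [] (x ∷ β) ok _ with length (x ∷ β) ≤ᵇ M * cnt D (x ∷ β) in eq
  ... | false = ≰⇒> λ le → subst T eq (≤⇒≤ᵇ le)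
  ¬overfull⇒few M D (x ∷ α) β ok β≢[] with length (x ∷ α ++ β) ≤ᵇ M * cnt D (x ∷ α ++ β)
  ... | false = ¬overfull⇒few M D α β ok β≢[]

  at-++ : ∀ {n} (Ψ : State n) τ s A ρ σ → at (length τ + s) Ψ A ρ (τ ++ σ) ≡ at s Ψ (A ⊕* τ) (τ ʳ++ ρ) σ
  at-++ Ψ []      s A ρ σ = refl
  at-++ Ψ (e ∷ τ) s A ρ σ = at-++ Ψ τ s (A ⊕ e) (e ∷ ρ) σ

  at-≢0 : ∀ {n} k (Ψ : State n) A ρ σ → at k Ψ A ρ σ ≢ 0 → k ≤ length σ
  at-≢0 zero    Ψ A ρ σ       _  = z≤n
  at-≢0 (suc k) Ψ A ρ []      ≢0 = contradiction refl ≢0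
  at-≢0 (suc k) Ψ A ρ (e ∷ σ) ≢0 = s≤s (at-≢0 k Ψ (A ⊕ e) (e ∷ ρ) σ ≢0)

  at-≤1 : ∀ {n} k (Ψ : State n) → (∀ A ρ σ → Ψ A ρ σ ≤ 1) → ∀ A ρ σ → at k Ψ A ρ σ ≤ 1
  at-≤1 zero    Ψ Ψ≤1 A ρ σ       = Ψ≤1 A ρ σ
  at-≤1 (suc k) Ψ Ψ≤1 A ρ []      = z≤n
  at-≤1 (suc k) Ψ Ψ≤1 A ρ (e ∷ σ) = at-≤1 k Ψ Ψ≤1 (A ⊕ e) (e ∷ ρ) σ

  χ≢0 : ∀ {b} → χ b ≢ 0 → b ≡ true
  χ≢0 {false} ≢0 = contradiction refl ≢0
  χ≢0 {true}  _  = refl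

  ∧-true : ∀ {a b} → a ∧ b ≡ true → a ≡ true × b ≡ true
  ∧-true {true} eq = refl , eq

  not-true : ∀ {a} → not a ≡ true → a ≡ false
  not-true {false} _ = refl

  sum-atMostOne : ∀ {m} (f : Fin m → ℕ) → (∀ i → f i ≤ 1) → (∀ i j → f i ≢ 0 → f j ≢ 0 → i ≡ j) → sum f ≤ 1
  sum-atMostOne {zero}  f f≤1 one = z≤n
  sum-atMostOne {suc m} f f≤1 one with f zero ≟ 0
  ... | yes f0≡0 rewrite f0≡0 = sum-atMostOne (f ∘ suc) (f≤1 ∘ suc) λ i j p q → Fin.suc-injective (one (suc i) (suc j) p q)
  ... | no  f0≢0 = +-mono-≤ (f≤1 zero) (≤-reflexive (trans (sum-cong-≗ rest) (sum-replicate-zero m)))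
    where
    rest : ∀ i → f (suc i) ≡ 0
    rest i with f (suc i) ≟ 0
    ... | yes eq = eq
    ... | no  ne = contradiction (one zero (suc i) f0≢0 ne) λ ()

  ≤S-antisym : ∀ {r} {x y : Fin r ⊎ Fin r} → x ≤S y → y ≤S x → x ≡ y
  ≤S-antisym a≤a     _ = refl
  ≤S-antisym b≤b     _ = refl
  ≤S-antisym (b≤a _) ()

  χ³≤1 : ∀ a b c → χ a * (χ b * χ c) ≤ 1
  χ³≤1 a b c = *-mono-≤ (χ≤1 a) (*-mono-≤ (χ≤1 b) (χ≤1 c))

  χ³≢0 : ∀ a b c → χ a * (χ b * χ c) ≢ 0 → a ≡ true × b ≡ true × c ≡ true
  χ³≢0 false _     _     ≢0 = contradiction refl ≢0
  χ³≢0 true  false _     ≢0 = contradiction refl ≢0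
  χ³≢0 true  true  false ≢0 = contradiction refl ≢0
  χ³≢0 true  true  true  _  = refl , refl , refl

  module Exchange {n : ℕ} (G : Subset n → Bool) where

    -- `Low` supplies a candidate for some bⱼ and `High` one for some aⱼ, with `e` as the point that
    -- separates them. Asking for `b ⊆ A ⊕ e` only, instead of `b ≡ A ⊕ e`, is what lets another set
    -- below `U` serve as the witness in `badL-unique`.
    Low High : Subset n → Fin n → Set
    Low  A e = ∃ λ b → G b ≡ true × e ∈ b × b ⊆ A ⊕ e
    High B e = ∃ λ a → G a ≡ true × e ∉ a × B ⊖ e ⊆ a

    low? : ∀ A e → Dec (Low A e)
    low? A e = anySubset? λ b → (G b Bool.≟ true) ×-dec (e ∈? b) ×-dec (b ⊆? A ⊕ e)

    high? : ∀ B e → Dec (High B e)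
    high? B e = anySubset? λ a → (G a Bool.≟ true) ×-dec ¬? (e ∈? a) ×-dec (B ⊖ e ⊆? a)

    badL badH : Subset n → Fin n → Bool
    badL A e = not (does (low? A e))
    badH B e = not (does (high? B e))

    badL-false : ∀ {A e} → badL A e ≡ false → Low A e
    badL-false {A} {e} eq with low? A e
    ... | yes low = low

    badL-true : ∀ {A e} → badL A e ≡ true → ¬ Low A e
    badL-true {A} {e} eq with low? A e
    ... | no ¬low = ¬low

    badH-false : ∀ {B e} → badH B e ≡ false → High B e
    badH-false {B} {e} eq with high? B e
    ... | yes high = high

    badH-true : ∀ {B e} → badH B e ≡ true → ¬ High B e
    badH-true {B} {e} eq with high? B e
    ... | no ¬high = ¬high

    -- If e and e′ both counted for U, then U ⊖ e would witness Low (U ⊖ e′) e′.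
    badL-unique : ∀ U → sum (λ e → χ (lookup U e) * (χ (G (U ⊖ e)) * χ (badL (U ⊖ e) e))) ≤ 1
    badL-unique U = sum-atMostOne _ (λ e → χ³≤1 (lookup U e) (G (U ⊖ e)) (badL (U ⊖ e) e)) unique
      where
      unique : ∀ e e′ → _ → _ → e ≡ e′
      unique e e′ p q with e Fin.≟ e′ | χ³≢0 (lookup U e) (G (U ⊖ e)) (badL (U ⊖ e) e) p
                         | χ³≢0 (lookup U e′) (G (U ⊖ e′)) (badL (U ⊖ e′) e′) q
      ... | yes e≡e′ | _ | _ = e≡e′
      ... | no  e≢e′ | _ , Ge , _ | e′∈U , _ , bad = contradiction
        (U ⊖ e , Ge , ∈-⊖⁺ (lookup⇒[]= e′ U e′∈U) (e≢e′ ∘ sym) ,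
         λ {x} x∈ → subst (x ∈_) (sym (⊖-⊕ U e′ e′∈U)) (proj₂ (∈-⊖⁻ {A = U} x∈)))
        (badL-true bad)

    -- If `e ≢ e′` both counted, `U ⊕ e` would avoid `e′` and contain `U`, hence witness
    -- `High (U ⊕ e′) e′`.
    badH-unique : ∀ U → sum (λ e → χ (not (lookup U e)) * (χ (G (U ⊕ e)) * χ (badH (U ⊕ e) e))) ≤ 1
    badH-unique U = sum-atMostOne _ (λ e → χ³≤1 (not (lookup U e)) (G (U ⊕ e)) (badH (U ⊕ e) e)) unique
      where
      unique : ∀ e e′ → _ → _ → e ≡ e′
      unique e e′ p q with e Fin.≟ e′ | χ³≢0 (not (lookup U e)) (G (U ⊕ e)) (badH (U ⊕ e) e) p
                         | χ³≢0 (not (lookup U e′)) (G (U ⊕ e′)) (badH (U ⊕ e′) e′) q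
      ... | yes e≡e′ | _ | _ = e≡e′
      ... | no  e≢e′ | _ , Ge , _ | e′∉U , _ , bad = contradiction
        (U ⊕ e , Ge , e′∉U⊕e , λ {x} x∈ → back (∈-⊖⁻ {A = U ⊕ e′} x∈))
        (badH-true bad)
        where
        e′∉U⊕e : e′ ∉ U ⊕ e
        e′∉U⊕e e′∈ with ∈-⊕⁻ {A = U} e′∈
        ... | inj₁ e′≡e = e≢e′ (sym e′≡e)
        ... | inj₂ e′∈U = contradiction (trans (sym ([]=⇒lookup e′∈U)) (not-true e′∉U)) λ ()
        back : ∀ {x} → x ≢ e′ × x ∈ U ⊕ e′ → x ∈ U ⊕ e
        back (x≢e′ , x∈) with ∈-⊕⁻ {A = U} x∈
        ... | inj₁ x≡e′ = contradiction x≡e′ x≢e′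
        ... | inj₂ x∈U  = ∈-⊕⁺ x∈U

    module _ (r : ℕ) (free : (f : Fin r ⊎ Fin r → Subset n) → Injective _≡_ _≡_ f → (∀ x → G (f x) ≡ true) →
                             ¬ (∀ x y → (x ≤S y → f x ⊆ f y) × (f x ⊆ f y → x ≤S y))) where

      -- The point e zero separates every a from every b, which r common good points cannot do for r ≤ 2.
      no-common-good : ∀ {A B} → A ⊆ B → (e : Fin (suc r) → Fin n) → (∀ i j → e i ≡ e j → i ≡ j) →
        (∀ i → e i ∉ A) → (∀ i → e i ∈ B) → (∀ i → Low A (e i)) → ¬ (∀ i → High B (e i))
      no-common-good {A} {B} A⊆B e e-inj e∉A e∈B low high = free f f-inj f∈G order
        where
        b a : Fin (suc r) → Subset n
        b i = proj₁ (low i)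
        a i = proj₁ (high i)
        e∈b : ∀ i → e i ∈ b i
        e∈b i = proj₁ (proj₂ (proj₂ (low i)))
        b⊆ : ∀ i → b i ⊆ A ⊕ e i
        b⊆ i = proj₂ (proj₂ (proj₂ (low i)))
        e∉a : ∀ i → e i ∉ a i
        e∉a i = proj₁ (proj₂ (proj₂ (high i)))
        ⊆a : ∀ i → B ⊖ e i ⊆ a i
        ⊆a i = proj₂ (proj₂ (proj₂ (high i)))
        -- Among the chosen points, `b j` contains only `e j`, since it adds nothing else to `A`,
        -- and `a j` misses only `e j`, since it loses nothing else of `B`.
        e∉b : ∀ {i j} → i ≢ j → e i ∉ b j
        e∉b {i} {j} i≢j ei∈bj with ∈-⊕⁻ {A = A} (b⊆ j ei∈bj)
        ... | inj₁ eq   = i≢j (e-inj i j eq)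
        ... | inj₂ ei∈A = e∉A i ei∈A
        e∈a : ∀ {i j} → i ≢ j → e i ∈ a j
        e∈a {i} {j} i≢j = ⊆a j (∈-⊖⁺ (e∈B i) (i≢j ∘ e-inj i j))
        b⊆a : ∀ {i j} → i ≢ j → b j ⊆ a i
        b⊆a {i} {j} i≢j {x} x∈b with ∈-⊕⁻ {A = A} (b⊆ j x∈b)
        ... | inj₁ refl = e∈a (i≢j ∘ sym)
        ... | inj₂ x∈A  = ⊆a i (∈-⊖⁺ (A⊆B x∈A) λ { refl → e∉A i x∈A })
        f : Fin r ⊎ Fin r → Subset n
        f (inj₁ i) = a (suc i)
        f (inj₂ j) = b (suc j)
        f∈G : ∀ x → G (f x) ≡ true
        f∈G (inj₁ i) = proj₁ (proj₂ (high (suc i)))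
        f∈G (inj₂ j) = proj₁ (proj₂ (low (suc j)))
        preserves : ∀ x y → x ≤S y → f x ⊆ f y
        preserves _ _ a≤a x∈ = x∈
        preserves _ _ b≤b x∈ = x∈
        preserves _ _ (b≤a i≢j) = b⊆a (i≢j ∘ Fin.suc-injective)
        reflects : ∀ x y → f x ⊆ f y → x ≤S y
        reflects (inj₁ i) (inj₁ j) ⊆ with i Fin.≟ j
        ... | yes refl = a≤a
        ... | no  i≢j  = contradiction (⊆ (e∈a (i≢j ∘ sym ∘ Fin.suc-injective))) (e∉a (suc j))
        reflects (inj₁ i) (inj₂ j) ⊆ = contradiction (⊆ (e∈a {zero} λ ())) (e∉b {zero} λ ())
        reflects (inj₂ i) (inj₁ j) ⊆ = b≤a λ { refl → e∉a (suc i) (⊆ (e∈b (suc i))) }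
        reflects (inj₂ i) (inj₂ j) ⊆ with i Fin.≟ j
        ... | yes refl = b≤b
        ... | no  i≢j  = contradiction (⊆ (e∈b (suc i))) (e∉b (i≢j ∘ Fin.suc-injective))
        order : ∀ x y → (x ≤S y → f x ⊆ f y) × (f x ⊆ f y → x ≤S y)
        order x y = preserves x y , reflects x y
        f-inj : Injective _≡_ _≡_ f
        f-inj {x} {y} eq = ≤S-antisym (reflects x y λ {z} → subst (z ∈_) eq) (reflects y x λ {z} → subst (z ∈_) (sym eq))

      M : ℕ
      M = 2 + r

      -- Both `ρ` and `σ` begin next to `A`, and `overfull` looks at suffixes; after the reversals
      -- the tested segments are those adjacent to `A`, below and above.
      clean : Subset n → List (Fin n) → List (Fin n) → Bool
      clean A ρ σ = G A ∧ not (overfull M (badH A) (reverse ρ)) ∧ not (overfull M (badL A) (reverse σ))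

      private
        good? : ∀ A B e → Dec (badL A e ≡ false × badH B e ≡ false)
        good? A B e = (badL A e Bool.≟ false) ×-dec (badH B e Bool.≟ false)

        goods : Subset n → Subset n → List (Fin n) → List (Fin n)
        goods A B = filter (good? A B)

        length-goods : ∀ A B τ → length τ ≤ length (goods A B τ) + (cnt (badL A) τ + cnt (badH B) τ)
        length-goods A B []      = z≤n
        length-goods A B (x ∷ τ) with badL A x | badH B x | length-goods A B τ
        ... | false | false | ih = s≤s ih
        ... | false | true  | ih = ≤-trans (s≤s ih) (≤-reflexive (move (length (goods A B τ)) (cnt (badL A) τ) (cnt (badH B) τ)))
          where
          move : ∀ a b c → suc (a + (b + c)) ≡ a + (b + suc c)
          move = solve-∀
        ... | true | b | ih = ≤-trans (s≤s ih) (≤-trans (≤-reflexive (move (length (goods A B τ)) (cnt (badL A) τ) (cnt (badH B) τ)))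
               (+-monoʳ-≤ (length (goods A B τ)) (+-monoʳ-≤ (suc (cnt (badL A) τ)) (m≤n+m _ (χ b)))))
          where
          move : ∀ a b c → suc (a + (b + c)) ≡ a + (suc b + c)
          move = solve-∀

        -- The origin of `M`: with fewer than s/M bad elements on either count, more than s(1 - 2/M)
        -- = sr/M remain, and this is at least r as soon as s ≥ M.
        many-good : ∀ s g c d → M ≤ s → s ≤ g + (c + d) → M * c < s → M * d < s → r < g
        many-good s g c d M≤s s≤ Mc<s Md<s = ≰⇒> λ g≤r → <-irrefl refl (begin-strict
          M * s               ≤⟨ *-monoʳ-≤ M s≤ ⟩
          M * (g + (c + d))   ≡⟨ distr M g c d ⟩
          M * g + (M * c + M * d) <⟨ +-mono-≤-< (*-monoʳ-≤ M g≤r) (+-mono-< Mc<s Md<s) ⟩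
          M * r + (s + s)     ≡⟨ cong (_+ (s + s)) (*-comm M r) ⟩
          r * M + (s + s)     ≤⟨ +-monoˡ-≤ (s + s) (*-monoʳ-≤ r M≤s) ⟩
          r * s + (s + s)     ≡⟨ comb r s ⟩
          M * s               ∎)
          where
          open ≤-Reasoning
          distr : ∀ m g c d → m * (g + (c + d)) ≡ m * g + (m * c + m * d)
          distr = solve-∀
          comb : ∀ r s → r * s + (s + s) ≡ (2 + r) * s
          comb = solve-∀

      -- The segment `τ` comes first after `A` and last before `A ⊕* τ`, so cleanness of both sets
      -- makes its bad elements rare for either. If it had `M` elements, `r + 1` of them would be
      -- good for both.
      clean-close : ∀ A ρ τ σ → Unique τ → (∀ {x} → x L.∈ τ → x ∉ A) →
        clean A ρ (τ ++ σ) ≡ true → clean (A ⊕* τ) (τ ʳ++ ρ) σ ≡ true → length τ < M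
      clean-close A ρ τ σ uniq τ∉A cleanA cleanB = ≰⇒> λ M≤τ →
        let τ≢[] : τ ≢ []
            τ≢[] = λ { refl → contradiction M≤τ λ () }
            r<g = many-good (length τ) (length gs) (cnt (badL A) τ) (cnt (badH B) τ) M≤τ (length-goods A B τ) (fewL τ≢[]) (fewH τ≢[])
            e = λ i → List.lookup gs (inject≤ i r<g)
            e∈ = λ i → ∈-filter⁻ (good? A B) {xs = τ} (∈-lookup {xs = gs} (inject≤ i r<g))
        in no-common-good (∈-⊕*⁺ˡ τ) e
             (λ i j eq → Fin.inject≤-injective r<g r<g i j (Unique-lookup-injective (Unique.filter⁺ (good? A B) uniq) _ _ eq))
             (λ i → τ∉A (proj₁ (e∈ i)))
             (λ i → ∈-⊕*⁺ʳ τ (proj₁ (e∈ i)))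
             (λ i → badL-false (proj₁ (proj₂ (e∈ i))))
             (λ i → badH-false (proj₂ (proj₂ (e∈ i))))
        where
        B = A ⊕* τ
        gs = goods A B τ
        fewL : τ ≢ [] → M * cnt (badL A) τ < length τ
        fewL τ≢[] = subst₂ (λ c l → M * c < l) (trans (cnt-ʳ++ (badL A) τ) (+-identityʳ _)) (length-reverse τ)
          (¬overfull⇒few M (badL A) (reverse σ) (reverse τ)
            (subst (λ xs → overfull M (badL A) xs ≡ false) (reverse-++ τ σ) (not-true (proj₂ (∧-true (proj₂ (∧-true {G A} cleanA))))))
            (τ≢[] ∘ reverse-injective))
        fewH : τ ≢ [] → M * cnt (badH B) τ < length τ
        fewH τ≢[] = ¬overfull⇒few M (badH B) (reverse ρ) τ
          (subst (λ xs → overfull M (badH B) xs ≡ false)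
            (trans (ʳ++-ʳ++ τ) (trans (ʳ++-defn ρ) (cong (reverse ρ ++_) (++-identityʳ τ))))
            (not-true (proj₁ (∧-true (proj₂ (∧-true {G B} cleanB))))))
          τ≢[]

      Clean : State n
      Clean A ρ σ = χ (clean A ρ σ)

      private
        -- Cuts `π` at the two hits: `τ₀` leads to the lower set, `τ` from there to the upper one,
        -- and `σ` is the rest.
        hits-close : ∀ π → Unique π → ∀ i s → at i Clean ∅ [] π ≢ 0 → at (i + s) Clean ∅ [] π ≢ 0 → s < M
        hits-close π uniq i s hit₁ hit₂ = subst (_< M) len₁
          (clean-close (∅ ⊕* τ₀) (τ₀ ʳ++ []) τ σ (Unique.take⁺ s (Unique.drop⁺ i uniq)) fresh
            (χ≢0 (subst (_≢ 0) here₁ hit₁)) (χ≢0 (subst (_≢ 0) here₂ hit₂)))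
          where
          τ₀ = take i π
          rest = drop i π
          τ = take s rest
          σ = drop s rest
          i+s≤ = at-≢0 (i + s) Clean ∅ [] π hit₂
          len₀ : length τ₀ ≡ i
          len₀ = trans (length-take i π) (m≤n⇒m⊓n≡m (≤-trans (m≤m+n i s) i+s≤))
          len₁ : length τ ≡ s
          len₁ = trans (length-take s rest) (m≤n⇒m⊓n≡m (≤-trans (≤-reflexive (sym (m+n∸m≡n i s)))
                   (≤-trans (∸-monoˡ-≤ i i+s≤) (≤-reflexive (sym (length-drop i π))))))
          jump : ∀ t → at (i + t) Clean ∅ [] π ≡ at t Clean (∅ ⊕* τ₀) (τ₀ ʳ++ []) rest
          jump t = trans (cong₂ (λ j xs → at (j + t) Clean ∅ [] xs) (sym len₀) (sym (take++drop≡id i π)))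
                         (at-++ Clean τ₀ t ∅ [] rest)
          here₁ : at i Clean ∅ [] π ≡ Clean (∅ ⊕* τ₀) (τ₀ ʳ++ []) (τ ++ σ)
          here₁ = trans (cong (λ j → at j Clean ∅ [] π) (sym (+-identityʳ i)))
            (trans (jump 0) (cong (Clean (∅ ⊕* τ₀) (τ₀ ʳ++ [])) (sym (take++drop≡id s rest))))
          here₂ : at (i + s) Clean ∅ [] π ≡ Clean (∅ ⊕* τ₀ ⊕* τ) (τ ʳ++ (τ₀ ʳ++ [])) σ
          here₂ = trans (jump s) (trans
            (cong₂ (λ j xs → at j Clean (∅ ⊕* τ₀) (τ₀ ʳ++ []) xs) (trans (sym len₁) (sym (+-identityʳ _))) (sym (take++drop≡id s rest)))
            (at-++ Clean τ 0 (∅ ⊕* τ₀) (τ₀ ʳ++ []) σ))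
          fresh : ∀ {x} → x L.∈ τ → x ∉ ∅ ⊕* τ₀
          fresh {x} x∈τ x∈A with ∈-⊕*⁻ τ₀ x∈A
          ... | inj₁ x∈∅  = ∉⊥ x∈∅
          ... | inj₂ x∈τ₀ = Unique-++ˡʳ τ₀ (subst Unique (sym (take++drop≡id i π)) uniq) x∈τ₀
                              (subst (x L.∈_) (take++drop≡id s rest) (∈-++⁺ˡ x∈τ))

      Σflags-Clean : Σflags Clean ≤ M * n !
      Σflags-Clean = Σflags-bound Clean M λ π p →
        sum-clustered (suc n) M (λ i → at i Clean ∅ [] π) (λ i → at-≤1 i Clean (λ A ρ σ → χ≤1 (clean A ρ σ)) ∅ [] π)
          (hits-close π (Arr-Unique p))

  -- Binomial coefficients

  2⌊n/2⌋≤n : ∀ n → ⌊ n /2⌋ + ⌊ n /2⌋ ≤ n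
  2⌊n/2⌋≤n n = ≤-trans (+-monoʳ-≤ ⌊ n /2⌋ (⌊n/2⌋≤⌈n/2⌉ n)) (≤-reflexive (⌊n/2⌋+⌈n/2⌉≡n n))

  n≤1+2⌊n/2⌋ : ∀ n → n ≤ suc (⌊ n /2⌋ + ⌊ n /2⌋)
  n≤1+2⌊n/2⌋ zero          = z≤n
  n≤1+2⌊n/2⌋ (suc zero)    = ≤-refl
  n≤1+2⌊n/2⌋ (suc (suc n)) = s≤s (s≤s (≤-trans (n≤1+2⌊n/2⌋ n) (≤-reflexive (sym (+-suc ⌊ n /2⌋ ⌊ n /2⌋)))))

  nCk*k![n∸k]!≡n! : ∀ {n k} → k ≤ n → (n C k) * (k ! * (n ∸ k) !) ≡ n !
  nCk*k![n∸k]!≡n! {n} {k} k≤n = trans (cong (_* (k ! * (n ∸ k) !)) (nCk≡n!/k![n-k]! k≤n)) (m/n*n≡m (k![n∸k]!∣n! k≤n))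
    where instance _ = k !* (n ∸ k) !≢0

  -- The absorption identity C(n,k+1)(k+1) = C(n,k)(n-k), with `n` written as `k + suc j` so that no
  -- truncated subtraction appears.
  nC[k+1]-absorb : ∀ k j → ((k + suc j) C suc k) * suc k ≡ ((k + suc j) C k) * suc j
  nC[k+1]-absorb k j = *-cancelʳ-≡ _ _ (k ! * j !) {{k !* j !≢0}} (begin
    (n C suc k) * suc k * (k ! * j !)   ≡⟨ left (n C suc k) (suc k) (k !) (j !) ⟩
    (n C suc k) * (suc k ! * j !)       ≡⟨ cong (λ i → (n C suc k) * (suc k ! * i !)) (sym n∸[1+k]) ⟩
    (n C suc k) * (suc k ! * (n ∸ suc k) !) ≡⟨ nCk*k![n∸k]!≡n! (≤-trans (m≤m+n (suc k) j) (≤-reflexive (sym (+-suc k j)))) ⟩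
    n !                                 ≡⟨ nCk*k![n∸k]!≡n! (m≤m+n k (suc j)) ⟨
    (n C k) * (k ! * (n ∸ k) !)         ≡⟨ cong (λ i → (n C k) * (k ! * i !)) (m+n∸m≡n k (suc j)) ⟩
    (n C k) * (k ! * (suc j * j !))     ≡⟨ right (n C k) (suc j) (k !) (j !) ⟩
    (n C k) * suc j * (k ! * j !)       ∎)
    where
    open ≡-Reasoning
    n = k + suc j
    n∸[1+k] : n ∸ suc k ≡ j
    n∸[1+k] = trans (cong (_∸ suc k) (+-suc k j)) (m+n∸m≡n (suc k) j)
    left : ∀ c k f g → c * k * (f * g) ≡ c * (k * f * g)
    left = solve-∀
    right : ∀ c j f g → c * (f * (j * g)) ≡ c * j * (f * g)
    right = solve-∀

  nCk≤nC[k+1] : ∀ n k → suc (k + k) ≤ n → n C k ≤ n C suc k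
  nCk≤nC[k+1] n k 2k<n with m≤n⇒∃[o]m+o≡n 2k<n
  ... | o , refl = *-cancelʳ-≤ _ _ (suc (k + o)) (begin
    (n C k) * suc (k + o)     ≡⟨ subst (λ n → (n C k) * suc (k + o) ≡ (n C suc k) * suc k) shape (sym (nC[k+1]-absorb k (k + o))) ⟩
    (n C suc k) * suc k       ≤⟨ *-monoʳ-≤ (n C suc k) (s≤s (m≤m+n k o)) ⟩
    (n C suc k) * suc (k + o) ∎)
    where
    open ≤-Reasoning
    shape : k + suc (k + o) ≡ suc (k + k) + o
    shape = trans (+-suc k (k + o)) (cong suc (sym (+-assoc k k o)))

  nC-mono : ∀ n {j k} → j ≤ k → k + k ≤ suc n → n C j ≤ n C k
  nC-mono n {j} {k} j≤k 2k≤1+n with m≤n⇒m<n∨m≡n j≤k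
  ... | inj₂ refl = ≤-refl
  nC-mono n {j} {suc k} j≤k 2k≤1+n | inj₁ (s≤s j≤k′) = ≤-trans
    (nC-mono n j≤k′ (≤-trans (+-mono-≤ (n≤1+n k) (n≤1+n k)) 2k≤1+n))
    (nCk≤nC[k+1] n k (s≤s⁻¹ (≤-trans (s≤s (≤-reflexive (sym (+-suc k k)))) 2k≤1+n)))

  nCk≤nC⌊n/2⌋ : ∀ n k → n C k ≤ n C ⌊ n /2⌋
  nCk≤nC⌊n/2⌋ n k with k ≤? ⌊ n /2⌋ | k ≤? n
  ... | yes k≤m | _ = nC-mono n k≤m (≤-trans (2⌊n/2⌋≤n n) (n≤1+n n))
  ... | no  k≰m | no k≰n = ≤-trans (≤-reflexive (k>n⇒nCk≡0 (≰⇒> k≰n))) z≤n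
  ... | no  k≰m | yes k≤n = ≤-trans (≤-reflexive (nCk≡nC[n∸k] k≤n))
    (nC-mono n n∸k≤m (≤-trans (2⌊n/2⌋≤n n) (n≤1+n n)))
    where
    n∸k≤m : n ∸ k ≤ ⌊ n /2⌋
    n∸k≤m = ≤-trans (∸-mono (n≤1+2⌊n/2⌋ n) (≰⇒> k≰m)) (≤-reflexive (m+n∸m≡n (suc ⌊ n /2⌋) ⌊ n /2⌋))

  -- C(n,k) − C(n,k−1) = C(n,k) (n+1−2k) / (n+1−k), telescoped.
  nC-tail : ∀ n d k → k + k + (d + d) ≤ suc n →
    (d + d) * sum {suc k} (λ i → n C toℕ i) ≤ suc n * (n C k)
  nC-tail n d zero    le = *-mono-≤ le (≤-reflexive (+-identityʳ (n C 0)))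
  nC-tail n d (suc k) le = begin
    (d + d) * sum {suc (suc k)} (λ i → n C toℕ i)
      ≡⟨ cong ((d + d) *_) (sum-last (suc k) (n C_)) ⟩
    (d + d) * (sum {suc k} (λ i → n C toℕ i) + (n C suc k)) ≡⟨ *-distribˡ-+ (d + d) (sum {suc k} (λ i → n C toℕ i)) _ ⟩
    (d + d) * sum {suc k} (λ i → n C toℕ i) + (d + d) * (n C suc k)
      ≤⟨ +-monoˡ-≤ _ (nC-tail n d k (≤-trans (+-monoˡ-≤ (d + d) (+-mono-≤ (n≤1+n k) (n≤1+n k))) le)) ⟩
    suc n * (n C k) + (d + d) * (n C suc k) ≤⟨ increment ⟩
    suc n * (n C suc k) ∎
    where
    open ≤-Reasoning
    2k+2+2d≤1+n : 2 + (k + k) + (d + d) ≤ suc n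
    2k+2+2d≤1+n = ≤-trans (≤-reflexive (cong (_+ (d + d)) (cong suc (sym (+-suc k k))))) le
    increment : suc n * (n C k) + (d + d) * (n C suc k) ≤ suc n * (n C suc k)
    -- With `o` the slack in this inequality, `suc j` is n - k. Multiplying by it lets the
    -- absorption identity replace the quotient of the two coefficients.
    increment with m≤n⇒∃[o]m+o≡n 2k+2+2d≤1+n
    ... | o , eq = *-cancelʳ-≤ _ _ (suc j) (begin
      (suc n * a + (d + d) * b) * suc j   ≡⟨ e₁ (suc n) a (d + d) b (suc j) ⟩
      suc n * (a * suc j) + (d + d) * b * suc j ≡⟨ cong (λ x → suc n * x + (d + d) * b * suc j) absorb ⟩
      suc n * (b * suc k) + (d + d) * b * suc j ≤⟨ +-monoʳ-≤ (suc n * (b * suc k)) (*-monoʳ-≤ ((d + d) * b) j≤n) ⟩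
      suc n * (b * suc k) + (d + d) * b * suc n ≡⟨ e₂ (suc n) b (suc k) (d + d) ⟩
      suc n * b * (suc k + (d + d)) ≤⟨ *-monoʳ-≤ (suc n * b) (m≤m+n _ o) ⟩
      suc n * b * (suc k + (d + d) + o) ≡⟨ cong (suc n * b *_) (e₃ k (d + d) o) ⟩
      suc n * b * suc j ∎)
      where
      a = n C k
      b = n C suc k
      j = k + (d + d) + o
      e₁ : ∀ n a d b j → (n * a + d * b) * j ≡ n * (a * j) + d * b * j
      e₁ = solve-∀
      e₂ : ∀ n b k d → n * (b * k) + d * b * n ≡ n * b * (k + d)
      e₂ = solve-∀
      e₃ : ∀ k d o → suc k + d + o ≡ suc (k + d + o)
      e₃ = solve-∀
      n≡ : k + suc j ≡ n
      n≡ = suc-injective (trans (e₄ k (d + d) o) eq)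
        where
        e₄ : ∀ k d o → suc (k + suc (k + d + o)) ≡ 2 + (k + k) + d + o
        e₄ = solve-∀
      j≤n : suc j ≤ suc n
      j≤n = s≤s (≤-trans (≤-trans (n≤1+n j) (m≤n+m (suc j) k)) (≤-reflexive n≡))
      absorb : a * suc j ≡ b * suc k
      absorb = subst (λ n → (n C k) * suc j ≡ (n C suc k) * suc k) n≡ (sym (nC[k+1]-absorb k j))

  -- The weighted count

  ΣS-levels : ∀ n (g : ℕ → ℕ) → ΣS {n} (λ A → g ∣ A ∣) ≡ sum {suc n} (λ i → (n C toℕ i) * g (toℕ i))
  ΣS-levels zero    g = sym (trans (+-identityʳ _) (*-identityˡ (g 0)))
  ΣS-levels (suc n) g = begin
    ΣS {n} (λ A → g ∣ A ∣) + ΣS {n} (λ A → g (suc ∣ A ∣))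
      ≡⟨ cong₂ _+_ (ΣS-levels n g) (ΣS-levels n (g ∘ suc)) ⟩
    sum {suc n} (λ i → (n C toℕ i) * g (toℕ i)) + sum {suc n} (λ i → (n C toℕ i) * g (suc (toℕ i)))
      ≡⟨ cong (_+ sum {suc n} (λ i → (n C toℕ i) * g (suc (toℕ i)))) (sym extend) ⟩
    sum {suc (suc n)} (λ i → (n C toℕ i) * g (toℕ i)) + sum {suc n} (λ i → (n C toℕ i) * g (suc (toℕ i)))
      ≡⟨ +-assoc ((n C 0) * g 0) _ _ ⟩
    (n C 0) * g 0 + (sum {suc n} (λ i → (n C suc (toℕ i)) * g (suc (toℕ i))) + sum {suc n} (λ i → (n C toℕ i) * g (suc (toℕ i))))
      ≡⟨ cong ((n C 0) * g 0 +_) (∑-distrib-+ {suc n} (λ i → (n C suc (toℕ i)) * g (suc (toℕ i))) (λ i → (n C toℕ i) * g (suc (toℕ i)))) ⟨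
    (n C 0) * g 0 + sum {suc n} (λ i → (n C suc (toℕ i)) * g (suc (toℕ i)) + (n C toℕ i) * g (suc (toℕ i)))
      ≡⟨ cong ((n C 0) * g 0 +_) (sum-cong-≗ {suc n} λ i → pascal (toℕ i)) ⟩
    sum {suc (suc n)} (λ i → (suc n C toℕ i) * g (toℕ i)) ∎
    where
    open ≡-Reasoning
    extend : sum {suc (suc n)} (λ i → (n C toℕ i) * g (toℕ i)) ≡ sum {suc n} (λ i → (n C toℕ i) * g (toℕ i))
    extend = trans (sum-last (suc n) (λ i → (n C i) * g i))
      (trans (cong (λ c → sum {suc n} (λ i → (n C toℕ i) * g (toℕ i)) + c * g (suc n)) (k>n⇒nCk≡0 (n<1+n n))) (+-identityʳ _))
    pascal : ∀ k → (n C suc k) * g (suc k) + (n C k) * g (suc k) ≡ (suc n C suc k) * g (suc k)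
    pascal k = trans (sym (*-distribʳ-+ (g (suc k)) (n C suc k) (n C k)))
      (cong (_* g (suc k)) (trans (+-comm (n C suc k) _) (nCk+nC[k+1]≡[n+1]C[k+1] n k)))

  -- The number of maximal chains through `A`; summed over a family it gives the Lubell function
  -- times `n !`.
  weight : ∀ {n} → Subset n → ℕ
  weight A = ∣ A ∣ ! * ∣ ∁ A ∣ !

  C*weight : ∀ {n} (A : Subset n) → (n C ∣ A ∣) * weight A ≡ n !
  C*weight {n} A = trans (cong (λ k → (n C ∣ A ∣) * (∣ A ∣ ! * k !)) (∣∁p∣≡n∸∣p∣ A)) (nCk*k![n∸k]!≡n! (∣p∣≤n A))

  -- One level wider at both ends than the band of sets of size and cosize at least `lo`, because
  -- bad pairs are charged to sets one element larger or smaller.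
  near : ℕ → ℕ → ℕ → Bool
  near n lo k = (lo ≤ᵇ suc k) ∧ (lo ≤ᵇ suc (n ∸ k))

  -- Every level has total weight exactly `n !`, and the levels from `lo − 1` to `n − lo + 1` number
  -- `n + 3 − 2 lo`.
  ΣS-near : ∀ n lo L → 2 ≤ lo → 3 + n ≤ L + (lo + lo) → ΣS {n} (λ U → χ (near n lo ∣ U ∣) * weight U) ≤ L * n !
  ΣS-near n lo L 2≤lo len = begin
    ΣS {n} (λ U → χ (near n lo ∣ U ∣) * weight U)
      ≡⟨ ΣS-cong {n} (λ U → cong (λ k → χ (near n lo ∣ U ∣) * (∣ U ∣ ! * k !)) (∣∁p∣≡n∸∣p∣ U)) ⟩
    ΣS {n} (λ U → χ (near n lo ∣ U ∣) * (∣ U ∣ ! * (n ∸ ∣ U ∣) !))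
      ≡⟨ ΣS-levels n (λ k → χ (near n lo k) * (k ! * (n ∸ k) !)) ⟩
    sum {suc n} (λ i → (n C toℕ i) * (χ (near n lo (toℕ i)) * (toℕ i ! * (n ∸ toℕ i) !)))
      ≡⟨ sum-cong-≗ {suc n} (λ i → trans (*-left-comm (n C toℕ i) (χ (near n lo (toℕ i))) _)
           (cong (χ (near n lo (toℕ i)) *_) (nCk*k![n∸k]!≡n! (s≤s⁻¹ (Fin.toℕ<n i))))) ⟩
    sum {suc n} (λ i → χ (near n lo (toℕ i)) * n !) ≡⟨ *-distribʳ-sum {suc n} (n !) (λ i → χ (near n lo (toℕ i))) ⟨
    sum {suc n} (λ i → χ (near n lo (toℕ i))) * n !
      ≤⟨ *-monoˡ-≤ (n !) (sum-clustered (suc n) L (χ ∘ near n lo) (λ i → χ≤1 (near n lo i)) close) ⟩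
    L * n ! ∎
    where
    open ≤-Reasoning
    ends : ∀ {k} → χ (near n lo k) ≢ 0 → lo ≤ suc k × lo ≤ suc (n ∸ k)
    ends {k} ≢0 with ∧-true {lo ≤ᵇ suc k} (χ≢0 ≢0)
    ... | p , q = ≤ᵇ⇒≤ lo _ (subst T (sym p) _) , ≤ᵇ⇒≤ lo _ (subst T (sym q) _)
    close : ∀ i s → χ (near n lo i) ≢ 0 → χ (near n lo (i + s)) ≢ 0 → s < L
    close i s p q = +-cancelʳ-≤ (lo + lo) (suc s) L (begin
      suc s + (lo + lo)         ≤⟨ +-monoʳ-≤ (suc s) (+-mono-≤ (proj₁ (ends p)) (proj₂ (ends {i + s} q))) ⟩
      suc s + (suc i + suc k)   ≡⟨ e s i k ⟩
      3 + (i + s + k)           ≡⟨ cong (3 +_) (m+[n∸m]≡n i+s≤n) ⟩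
      3 + n                     ≤⟨ len ⟩
      L + (lo + lo)             ∎)
      where
      k = n ∸ (i + s)
      e : ∀ s i k → suc s + (suc i + suc k) ≡ 3 + (i + s + k)
      e = solve-∀
      -- Above level n the truncated difference is 0, which would force `lo ≤ 1`.
      i+s≤n : i + s ≤ n
      i+s≤n = <⇒≤ (m∸n≢0⇒n<m λ k≡0 → contradiction (≤-trans 2≤lo (subst (λ k → lo ≤ suc k) k≡0 (proj₂ (ends {i + s} q)))) λ { (s≤s ()) })

  arr-const : ∀ {n} k (E : Subset n) → ∣ E ∣ ≡ k → ∀ c → arr k E (const c) ≡ c * k !
  arr-const k E ∣E∣≡k c = trans (arr-cong k E λ _ → sym (*-identityʳ c))
    (trans (arr-* k E c (const 1)) (cong (c *_) (arr-1 k E ∣E∣≡k)))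

  -- Union bound over the flags marked at `A`: one that is not clean is overfull above, controlled
  -- by `D₁` on `B`, or below, controlled by `D₂` on `A`, and the ballot theorem bounds each kind.
  flags-split : ∀ {n} M g (D₁ D₂ : Fin n → Bool) A B →
    χ g * (∣ A ∣ ! * ∣ B ∣ !) ≤
    perm A (λ ρ → perm B λ σ → χ (g ∧ not (overfull M D₂ (reverse ρ)) ∧ not (overfull M D₁ (reverse σ)))) +
    M * (χ g * (∣ A ∣ ! * (wt D₁ B * pred ∣ B ∣ !)) + χ g * (∣ B ∣ ! * (wt D₂ A * pred ∣ A ∣ !)))
  flags-split M false D₁ D₂ A B = z≤n
  flags-split {n} M true  D₁ D₂ A B = begin
    1 * (a ! * b !) ≡⟨ *-identityˡ _ ⟩
    a ! * b !       ≡⟨ *-comm (a !) (b !) ⟩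
    b ! * a !       ≡⟨ arr-const a A refl (b !) ⟨
    perm A (λ ρ → b !) ≡⟨ arr-cong a A (λ _ → sym (arr-1 b B refl)) ⟩
    perm A (λ ρ → perm B (λ σ → 1))
      ≤⟨ arr-mono a A (λ ρ _ → arr-mono b B λ σ _ → cases (x ρ) (y σ)) ⟩
    perm A (λ ρ → perm B λ σ → χ (not (x ρ) ∧ not (y σ)) + (χ (y σ) + χ (x ρ)))
      ≡⟨ arr-cong a A (λ ρ → trans (arr-+ b B _ _) (cong (perm B (λ σ → χ (not (x ρ) ∧ not (y σ))) +_)
           (trans (arr-+ b B _ _) (cong (perm B (χ ∘ y) +_) (arr-const b B refl (χ (x ρ))))))) ⟩
    perm A (λ ρ → perm B (λ σ → χ (not (x ρ) ∧ not (y σ))) + (perm B (χ ∘ y) + χ (x ρ) * b !))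
      ≡⟨ trans (arr-+ a A _ _) (cong (clean +_) (trans (arr-+ a A _ _)
           (cong₂ _+_ (arr-const a A refl _) (trans (arr-cong a A (λ ρ → *-comm (χ (x ρ)) (b !))) (arr-* a A (b !) _))))) ⟩
    clean + (perm B (χ ∘ y) * a ! + b ! * perm A (χ ∘ x))
      ≤⟨ +-monoʳ-≤ clean (+-mono-≤ (*-monoˡ-≤ (a !) (≤-trans (≤-reflexive (arr-reverse b B (χ ∘ overfull M D₁))) (overfull-bound M D₁ b B refl)))
           (*-monoʳ-≤ (b !) (≤-trans (≤-reflexive (arr-reverse a A (χ ∘ overfull M D₂))) (overfull-bound M D₂ a A refl)))) ⟩
    clean + (M * wt D₁ B * pred b ! * a ! + b ! * (M * wt D₂ A * pred a !))
      ≡⟨ cong (clean +_) (rearrange M (wt D₁ B) (pred b !) (a !) (b !) (wt D₂ A) (pred a !)) ⟩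
    clean + M * (1 * (a ! * (wt D₁ B * pred b !)) + 1 * (b ! * (wt D₂ A * pred a !))) ∎
    where
    open ≤-Reasoning
    a = ∣ A ∣
    b = ∣ B ∣
    x y : List (Fin n) → Bool
    x ρ = overfull M D₂ (reverse ρ)
    y σ = overfull M D₁ (reverse σ)
    clean = perm A (λ ρ → perm B λ σ → χ (not (x ρ) ∧ not (y σ)))
    cases : ∀ x y → 1 ≤ χ (not x ∧ not y) + (χ y + χ x)
    cases false false = ≤-refl
    cases false true  = ≤-refl
    cases true  false = ≤-refl
    cases true  true  = s≤s z≤n
    rearrange : ∀ M u p a b v q → M * u * p * a + b * (M * v * q) ≡ M * (1 * (a * (u * p)) + 1 * (b * (v * q)))
    rearrange = solve-∀

  ∣∁⊖∣ : ∀ {n} (U : Subset n) e → lookup U e ≡ true → ∣ ∁ (U ⊖ e) ∣ ≡ suc ∣ ∁ U ∣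
  ∣∁⊖∣ U e e∈U = trans (∣⊖∣ (∁ (U ⊖ e)) e (trans (lookup-map e not (U ⊖ e)) (cong not (lookup-⊖ U e))))
    (cong (suc ∘ ∣_∣) (∁-⊖ U e e∈U))

  k*[k-1]!≤k! : ∀ lo k → lo ≤ k → lo * pred k ! ≤ k !
  k*[k-1]!≤k! lo zero    z≤n  = z≤n
  k*[k-1]!≤k! lo (suc k) lo≤k = *-monoˡ-≤ (k !) lo≤k

  near-true : ∀ {n lo k j} → lo ≤ suc k → lo ≤ suc j → j ≡ n ∸ k → near n lo k ≡ true
  near-true {n} {lo} {k} p q refl with lo ≤ᵇ suc k in eq₁ | lo ≤ᵇ suc (n ∸ k) in eq₂
  ... | true  | true  = refl
  ... | false | _     = contradiction (subst T eq₁ (≤⇒≤ᵇ p)) λ ()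
  ... | true  | false = contradiction (subst T eq₂ (≤⇒≤ᵇ q)) λ ()

  -- Double counting of bad elements and the LYM inequality

  module Weights {n : ℕ} (G : Subset n → Bool) (lo : ℕ)
    (central : ∀ A → G A ≡ true → lo ≤ ∣ A ∣ × lo ≤ ∣ ∁ A ∣) where

    open Exchange G

    -- Each member contributes its `weight` times the proportion of bad elements outside it,
    -- respectively inside it; `pred` carries out the division by the size.
    badL-weight badH-weight : ℕ
    badL-weight = ΣS λ A → χ (G A) * (∣ A ∣ ! * (wt (badL A) (∁ A) * pred ∣ ∁ A ∣ !))
    badH-weight = ΣS λ A → χ (G A) * (∣ ∁ A ∣ ! * (wt (badH A) A * pred ∣ A ∣ !))

    private
      nearWeight : ℕ
      nearWeight = ΣS {n} λ U → χ (near n lo ∣ U ∣) * weight U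

      atMostOne : ∀ (t : Fin n → ℕ) Y → sum t ≤ 1 → sum (λ e → t e * Y) ≤ Y
      atMostOne t Y t≤1 = ≤-trans (≤-reflexive (sym (*-distribʳ-sum Y t))) (≤-trans (*-monoˡ-≤ Y t≤1) (≤-reflexive (*-identityˡ Y)))

      pull : ∀ l a b c x → l * (a * (b * (c * x))) ≡ a * (b * (c * (l * x)))
      pull = solve-∀

      term-mono : ∀ a b c {l X Y} → (a ≡ true → b ≡ true → l * X ≤ Y) →
        l * (χ a * (χ b * (χ c * X))) ≤ χ a * (χ b * χ c) * Y
      term-mono a b c {l} {X} {Y} h = begin
        l * (χ a * (χ b * (χ c * X))) ≡⟨ pull l (χ a) (χ b) (χ c) X ⟩
        χ a * (χ b * (χ c * (l * X))) ≤⟨ χ-mono a (λ p → χ-mono b λ q → *-monoʳ-≤ (χ c) (h p q)) ⟩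
        χ a * (χ b * (χ c * Y)) ≡⟨ assoc (χ a) (χ b) (χ c) Y ⟩
        χ a * (χ b * χ c) * Y ∎
        where
        open ≤-Reasoning
        assoc : ∀ a b c y → a * (b * (c * y)) ≡ a * (b * c) * y
        assoc = solve-∀

      expand : ∀ g (D : Fin n → Bool) (u : Fin n → Bool) p q →
        g * (p * (sum (λ e → χ (u e) * χ (D e)) * q)) ≡ sum (λ e → χ (u e) * (g * (χ (D e) * (p * q))))
      expand g D u p q = begin
        g * (p * (sum (λ e → χ (u e) * χ (D e)) * q)) ≡⟨ e₁ g p _ q ⟩
        g * (p * q) * sum (λ e → χ (u e) * χ (D e))   ≡⟨ *-distribˡ-sum (g * (p * q)) (λ e → χ (u e) * χ (D e)) ⟩
        sum (λ e → g * (p * q) * (χ (u e) * χ (D e))) ≡⟨ sum-cong-≗ (λ e → e₂ g (p * q) (χ (u e)) (χ (D e))) ⟩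
        sum (λ e → χ (u e) * (g * (χ (D e) * (p * q)))) ∎
        where
        open ≡-Reasoning
        e₁ : ∀ g p s q → g * (p * (s * q)) ≡ g * (p * q) * s
        e₁ = solve-∀
        e₂ : ∀ g x u d → g * x * (u * d) ≡ u * (g * (d * x))
        e₂ = solve-∀

    -- Charge (A, e) to U = A ∪ {e}. By `badL-unique` each U pays once, and it pays `weight U`
    -- divided by |U|, where |U| is at least `lo`.
    badL-weight≤ : lo * badL-weight ≤ nearWeight
    badL-weight≤ = begin
      lo * badL-weight ≡⟨ cong (lo *_) (trans (ΣS-cong λ A → trans
          (expand (χ (G A)) (badL A) (lookup (∁ A)) (∣ A ∣ !) (pred ∣ ∁ A ∣ !))
          (sum-cong-≗ λ e → cong (λ b → χ b * h A e) (lookup-map e not A))) (ΣS-flip h)) ⟩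
      lo * ΣS (λ U → sum λ e → χ (lookup U e) * h (U ⊖ e) e) ≡⟨ *-distribˡ-ΣS lo (λ U → sum λ e → χ (lookup U e) * h (U ⊖ e) e) ⟩
      ΣS (λ U → lo * sum λ e → χ (lookup U e) * h (U ⊖ e) e)
        ≤⟨ ΣS-mono (λ U → ≤-trans (≤-reflexive (*-distribˡ-sum lo (λ e → χ (lookup U e) * h (U ⊖ e) e)))
             (≤-trans (sum-mono (λ e → term-mono (lookup U e) (G (U ⊖ e)) (badL (U ⊖ e) e) {lo} (step U e)))
               (atMostOne (λ e → χ (lookup U e) * (χ (G (U ⊖ e)) * χ (badL (U ⊖ e) e))) (χ (near n lo ∣ U ∣) * weight U) (badL-unique U)))) ⟩
      nearWeight ∎
      where
      open ≤-Reasoning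
      h : Subset n → Fin n → ℕ
      h A e = χ (G A) * (χ (badL A e) * (∣ A ∣ ! * pred ∣ ∁ A ∣ !))
      step : ∀ U e → lookup U e ≡ true → G (U ⊖ e) ≡ true →
        lo * (∣ U ⊖ e ∣ ! * pred ∣ ∁ (U ⊖ e) ∣ !) ≤ χ (near n lo ∣ U ∣) * weight U
      step U e e∈U Ge with central (U ⊖ e) Ge
      ... | lo≤ , lo≤∁ rewrite ∣∁⊖∣ U e e∈U
        | near-true {n} {lo} {∣ U ∣} {∣ ∁ U ∣} (≤-trans lo≤ (≤-trans (n≤1+n _) (≤-trans (≤-reflexive (sym (∣⊖∣ U e e∈U))) (n≤1+n _)))) lo≤∁ (∣∁p∣≡n∸∣p∣ U)
        | ∣⊖∣ U e e∈U = begin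
          lo * (∣ U ⊖ e ∣ ! * ∣ ∁ U ∣ !)   ≡⟨ *-assoc lo (∣ U ⊖ e ∣ !) (∣ ∁ U ∣ !) ⟨
          lo * ∣ U ⊖ e ∣ ! * ∣ ∁ U ∣ !     ≤⟨ *-monoˡ-≤ (∣ ∁ U ∣ !) (*-monoˡ-≤ (∣ U ⊖ e ∣ !) (≤-trans lo≤ (n≤1+n _))) ⟩
          suc ∣ U ⊖ e ∣ ! * ∣ ∁ U ∣ !      ≡⟨ *-identityˡ _ ⟨
          1 * (suc ∣ U ⊖ e ∣ ! * ∣ ∁ U ∣ !) ∎

    -- Dually, (A, e) is charged to A without e, and the divisor is the size of the complement of
    -- that set.
    badH-weight≤ : lo * badH-weight ≤ nearWeight
    badH-weight≤ = begin
      lo * badH-weight ≡⟨ cong (lo *_) (trans (ΣS-cong λ A → expand (χ (G A)) (badH A) (lookup A) (∣ ∁ A ∣ !) (pred ∣ A ∣ !))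
         (trans (ΣS-cong λ A → sum-cong-≗ λ e → χ-cong (lookup A e) λ e∈A → cong (λ U → h U e) (sym (⊖-⊕ A e e∈A)))
           (sym (ΣS-flip (λ U e → h (U ⊕ e) e))))) ⟩
      lo * ΣS (λ U → sum λ e → χ (not (lookup U e)) * h (U ⊕ e) e) ≡⟨ *-distribˡ-ΣS lo (λ U → sum λ e → χ (not (lookup U e)) * h (U ⊕ e) e) ⟩
      ΣS (λ U → lo * sum λ e → χ (not (lookup U e)) * h (U ⊕ e) e)
        ≤⟨ ΣS-mono (λ U → ≤-trans (≤-reflexive (*-distribˡ-sum lo (λ e → χ (not (lookup U e)) * h (U ⊕ e) e)))
             (≤-trans (sum-mono (λ e → term-mono (not (lookup U e)) (G (U ⊕ e)) (badH (U ⊕ e) e) {lo} (step U e)))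
               (atMostOne (λ e → χ (not (lookup U e)) * (χ (G (U ⊕ e)) * χ (badH (U ⊕ e) e))) (χ (near n lo ∣ U ∣) * weight U) (badH-unique U)))) ⟩
      nearWeight ∎
      where
      open ≤-Reasoning
      h : Subset n → Fin n → ℕ
      h A e = χ (G A) * (χ (badH A e) * (∣ ∁ A ∣ ! * pred ∣ A ∣ !))
      ⊕-⊖ : ∀ {n} (U : Subset n) e → lookup U e ≡ false → U ⊕ e ⊖ e ≡ U
      ⊕-⊖ (false ∷ U) zero    _   = refl
      ⊕-⊖ (u ∷ U)     (suc e) e∉U = cong (u ∷_) (⊕-⊖ U e e∉U)
      step : ∀ U e → not (lookup U e) ≡ true → G (U ⊕ e) ≡ true →
        lo * (∣ ∁ (U ⊕ e) ∣ ! * pred ∣ U ⊕ e ∣ !) ≤ χ (near n lo ∣ U ∣) * weight U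
      step U e e∉U Ge = goal
        where
        V = U ⊕ e
        lo≤ = proj₁ (central V Ge)
        lo≤∁ = proj₂ (central V Ge)
        V⊖e : V ⊖ e ≡ U
        V⊖e = ⊕-⊖ U e (not-true e∉U)
        ∣V∣ : ∣ V ∣ ≡ suc ∣ U ∣
        ∣V∣ = trans (∣⊖∣ V e (lookup-⊕ U e)) (cong (suc ∘ ∣_∣) V⊖e)
        ∣∁U∣ : ∣ ∁ U ∣ ≡ suc ∣ ∁ V ∣
        ∣∁U∣ = trans (cong (∣_∣ ∘ ∁) (sym V⊖e)) (∣∁⊖∣ V e (lookup-⊕ U e))
        goal : lo * (∣ ∁ V ∣ ! * pred ∣ V ∣ !) ≤ χ (near n lo ∣ U ∣) * weight U
        goal rewrite ∣V∣
          | near-true {n} {lo} {∣ U ∣} {∣ ∁ U ∣} (subst (lo ≤_) ∣V∣ lo≤)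
              (≤-trans lo≤∁ (≤-trans (n≤1+n _) (≤-trans (≤-reflexive (sym ∣∁U∣)) (n≤1+n _)))) (∣∁p∣≡n∸∣p∣ U)
          | ∣∁U∣ = begin
            lo * (∣ ∁ V ∣ ! * ∣ U ∣ !)     ≡⟨ *-assoc lo (∣ ∁ V ∣ !) (∣ U ∣ !) ⟨
            lo * ∣ ∁ V ∣ ! * ∣ U ∣ !       ≤⟨ *-monoˡ-≤ (∣ U ∣ !) (*-monoˡ-≤ (∣ ∁ V ∣ !) (≤-trans lo≤∁ (n≤1+n _))) ⟩
            suc ∣ ∁ V ∣ ! * ∣ U ∣ !        ≡⟨ *-comm (suc ∣ ∁ V ∣ !) (∣ U ∣ !) ⟩
            ∣ U ∣ ! * suc ∣ ∁ V ∣ !        ≡⟨ *-identityˡ _ ⟨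
            1 * (∣ U ∣ ! * suc ∣ ∁ V ∣ !) ∎

    module _ (r : ℕ) (free : (f : Fin r ⊎ Fin r → Subset n) → Injective _≡_ _≡_ f → (∀ x → G (f x) ≡ true) →
                             ¬ (∀ x y → (x ≤S y → f x ⊆ f y) × (f x ⊆ f y → x ≤S y))) where

      private
        K = 2 + r

      -- Each of the `n !` chains carries at most `K` clean flags; the remaining flags cost `K`
      -- times the bad proportions.
      total-weight : ΣS (λ A → χ (G A) * weight A) ≤ K * n ! + K * (badL-weight + badH-weight)
      total-weight = begin
        ΣS (λ A → χ (G A) * weight A)
          ≤⟨ ΣS-mono (λ A → flags-split K (G A) (badL A) (badH A) A (∁ A)) ⟩
        ΣS (λ A → perm A (λ ρ → perm (∁ A) (Clean r free A ρ)) + K * (l A + u A)) ≡⟨ ΣS-distrib-+ (λ A → perm A (λ ρ → perm (∁ A) (Clean r free A ρ))) _ ⟩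
        Σflags (Clean r free) + ΣS (λ A → K * (l A + u A))
          ≡⟨ cong (Σflags (Clean r free) +_) (trans (sym (*-distribˡ-ΣS K (λ A → l A + u A))) (cong (K *_) (ΣS-distrib-+ l u))) ⟩
        Σflags (Clean r free) + K * (badL-weight + badH-weight)
          ≤⟨ +-monoˡ-≤ (K * (badL-weight + badH-weight)) (Σflags-Clean r free) ⟩
        K * n ! + K * (badL-weight + badH-weight) ∎
        where
        open ≤-Reasoning
        l u : Subset n → ℕ
        l A = χ (G A) * (∣ A ∣ ! * (wt (badL A) (∁ A) * pred ∣ ∁ A ∣ !))
        u A = χ (G A) * (∣ ∁ A ∣ ! * (wt (badH A) A * pred ∣ A ∣ !))

      -- Every set has `weight` at least n!/C(n,⌊n/2⌋), so the total weight bounds the number of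
      -- members. The factor `lo` clears the denominator left by the double counts.
      central-bound : ∀ L → 2 ≤ lo → 3 + n ≤ L + (lo + lo) →
        lo * ΣS (χ ∘ G) ≤ (n C ⌊ n /2⌋) * (lo * K + K * (L + L))
      central-bound L 2≤lo len = *-cancelʳ-≤ _ _ (n !) {{n !≢0}} (begin
        lo * ΣS (χ ∘ G) * n !                ≡⟨ trans (*-assoc lo _ _) (cong (lo *_) (*-comm (ΣS (χ ∘ G)) (n !))) ⟩
        lo * (n ! * ΣS (χ ∘ G))              ≡⟨ cong (lo *_) (*-distribˡ-ΣS (n !) (χ ∘ G)) ⟩
        lo * ΣS (λ A → n ! * χ (G A))        ≤⟨ *-monoʳ-≤ lo (ΣS-mono λ A → begin
            n ! * χ (G A)                    ≡⟨ cong (_* χ (G A)) (C*weight A) ⟨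
            (n C ∣ A ∣) * weight A * χ (G A) ≤⟨ *-monoˡ-≤ (χ (G A)) (*-monoˡ-≤ (weight A) (nCk≤nC⌊n/2⌋ n ∣ A ∣)) ⟩
            c * weight A * χ (G A)           ≡⟨ trans (*-assoc c (weight A) _) (cong (c *_) (*-comm (weight A) _)) ⟩
            c * (χ (G A) * weight A)         ∎) ⟩
        lo * ΣS (λ A → c * (χ (G A) * weight A)) ≡⟨ cong (lo *_) (*-distribˡ-ΣS c (λ A → χ (G A) * weight A)) ⟨
        lo * (c * ΣS (λ A → χ (G A) * weight A)) ≤⟨ *-monoʳ-≤ lo (*-monoʳ-≤ c total-weight) ⟩
        lo * (c * (K * n ! + K * (badL-weight + badH-weight))) ≡⟨ e₁ lo c K (n !) badL-weight badH-weight ⟩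
        c * (lo * K * n ! + K * (lo * badL-weight + lo * badH-weight))
          ≤⟨ *-monoʳ-≤ c (+-monoʳ-≤ (lo * K * n !) (*-monoʳ-≤ K (+-mono-≤ (≤-trans badL-weight≤ near≤) (≤-trans badH-weight≤ near≤)))) ⟩
        c * (lo * K * n ! + K * (L * n ! + L * n !)) ≡⟨ e₂ c (lo * K) (n !) K L ⟩
        c * (lo * K + K * (L + L)) * n ! ∎)
        where
        open ≤-Reasoning
        c = n C ⌊ n /2⌋
        near≤ = ΣS-near n lo L 2≤lo len
        e₁ : ∀ l c k f x y → l * (c * (k * f + k * (x + y))) ≡ c * (l * k * f + k * (l * x + l * y))
        e₁ = solve-∀
        e₂ : ∀ c a f k l → c * (a * f + k * (l * f + l * f)) ≡ c * (a + k * (l + l)) * f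
        e₂ = solve-∀

  -- Families of central sets and tails

  module _ {n : ℕ} where
    open DecMembership (≡-dec {n = n} Bool._≟_) public using () renaming (_∈?_ to _∈ₗ?_)

  ΣS-∁ : ∀ {n} (f : Subset n → ℕ) → ΣS (f ∘ ∁) ≡ ΣS f
  ΣS-∁ {zero}  f = refl
  ΣS-∁ {suc n} f = trans (cong₂ _+_ (ΣS-∁ (f ∘ (inside ∷_))) (ΣS-∁ (f ∘ (outside ∷_)))) (+-comm (ΣS (f ∘ (inside ∷_))) _)

  ΣS-single : ∀ {n} (A : Subset n) (f : Subset n → ℕ) → f A ≤ ΣS f
  ΣS-single []          f = ≤-refl
  ΣS-single (false ∷ A) f = ≤-trans (ΣS-single A (f ∘ (outside ∷_))) (m≤m+n _ _)
  ΣS-single (true ∷ A)  f = ≤-trans (ΣS-single A (f ∘ (inside ∷_))) (m≤n+m _ _)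

  length≤ΣS : ∀ {n} (xs : List (Subset n)) → Unique xs → length xs ≤ ΣS (λ A → χ (does (A ∈ₗ? xs)))
  length≤ΣS []       _         = z≤n
  length≤ΣS (x ∷ xs) (x∉ ∷ u) = begin
    1 + length xs ≤⟨ +-mono-≤ (≤-trans (≤-reflexive (sym (cong χ (dec-true (≡-dec Bool._≟_ x x) refl))))
                                (ΣS-single x (λ A → χ (does (≡-dec Bool._≟_ A x))))) (length≤ΣS xs u) ⟩
    ΣS (λ A → χ (does (≡-dec Bool._≟_ A x))) + ΣS (λ A → χ (does (A ∈ₗ? xs))) ≡⟨ ΣS-distrib-+ (λ A → χ (does (≡-dec Bool._≟_ A x))) _ ⟨
    ΣS (λ A → χ (does (≡-dec Bool._≟_ A x)) + χ (does (A ∈ₗ? xs))) ≤⟨ ΣS-mono pointwise ⟩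
    ΣS (λ A → χ (does (A ∈ₗ? (x ∷ xs)))) ∎
    where
    open ≤-Reasoning
    pointwise : ∀ A → χ (does (≡-dec Bool._≟_ A x)) + χ (does (A ∈ₗ? xs)) ≤ χ (does (A ∈ₗ? (x ∷ xs)))
    pointwise A with ≡-dec Bool._≟_ A x | A ∈ₗ? xs
    ... | yes refl | yes x∈ = contradiction refl (All.lookup x∉ x∈)
    ... | yes refl | no  _  = ≤-refl
    ... | no  _    | yes _  = ≤-refl
    ... | no  _    | no  _  = ≤-refl

  private
    sum-cutoff : ∀ N k (f : ℕ → ℕ) → sum {N} (λ i → f (toℕ i) * χ (toℕ i <ᵇ k)) ≤ sum {k} (f ∘ toℕ)
    sum-cutoff zero    k       f = z≤n
    sum-cutoff (suc N) zero    f = ≤-trans (≤-reflexive (cong (_+ sum {N} (λ i → f (suc (toℕ i)) * 0)) (*-zeroʳ (f 0)))) (sum-cutoff N zero (f ∘ suc))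
    sum-cutoff (suc N) (suc k) f = +-mono-≤ (≤-reflexive (*-identityʳ (f 0))) (sum-cutoff N k (f ∘ suc))

    sum-tail : ∀ k d (g : ℕ → ℕ) c → (∀ i → k ≤ i → i ≤ k + d → c ≤ g i) → d * c ≤ sum {suc (k + d)} (g ∘ toℕ)
    sum-tail zero    d g c c≤ = head d g (λ i → c≤ i z≤n)
      where
      head : ∀ d g → (∀ i → i ≤ d → c ≤ g i) → d * c ≤ sum {suc d} (g ∘ toℕ)
      head zero    g c≤ = z≤n
      head (suc d) g c≤ = +-mono-≤ (c≤ 0 z≤n) (head d (g ∘ suc) (λ i → c≤ (suc i) ∘ s≤s))
    sum-tail (suc k) d g c c≤ = ≤-trans (sum-tail k d (g ∘ suc) c (λ i p q → c≤ (suc i) (s≤s p) (s≤s q))) (m≤n+m _ (g 0))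

  -- Two uses of `nC-tail`. At `k` it bounds the tail by (n+1)/(2d) times C(n,k); as the next d
  -- levels are no smaller, d C(n,k) is at most the tail at `k + d`, where it applies again. The
  -- resulting order n²/d³ is enough because d will be linear in n.
  lower-tail : ∀ n d k → k + (d + d) ≤ ⌊ n /2⌋ →
    4 * (d * d * d) * sum {suc k} (λ i → n C toℕ i) ≤ suc n * suc n * (n C ⌊ n /2⌋)
  lower-tail n d k k+2d≤m = begin
    4 * (d * d * d) * τ                  ≡⟨ e₁ d τ ⟩
    d * (d + d) * ((d + d) * τ)          ≤⟨ *-monoʳ-≤ (d * (d + d)) (nC-tail n d k (≤-trans (≤-trans (+-monoʳ-≤ (k + k) (m≤m+n (d + d) (d + d))) (≤-reflexive (e₂ k d))) (twice k+2d≤m))) ⟩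
    d * (d + d) * (suc n * (n C k))      ≡⟨ e₃ d (suc n) (n C k) ⟩
    suc n * ((d + d) * (d * (n C k)))    ≤⟨ *-monoʳ-≤ (suc n) (*-monoʳ-≤ (d + d) (sum-tail k d (n C_) (n C k)
                                              λ i k≤i i≤k+d → nC-mono n k≤i (≤-trans (+-mono-≤ i≤k+d i≤k+d) 2[k+d]≤1+n))) ⟩
    suc n * ((d + d) * sum {suc (k + d)} (λ i → n C toℕ i)) ≤⟨ *-monoʳ-≤ (suc n) (nC-tail n d (k + d) (≤-trans (≤-reflexive (e₄ k d)) (twice k+2d≤m))) ⟩
    suc n * (suc n * (n C (k + d)))      ≤⟨ *-monoʳ-≤ (suc n) (*-monoʳ-≤ (suc n) (nCk≤nC⌊n/2⌋ n (k + d))) ⟩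
    suc n * (suc n * (n C ⌊ n /2⌋))      ≡⟨ *-assoc (suc n) (suc n) _ ⟨
    suc n * suc n * (n C ⌊ n /2⌋)        ∎
    where
    open ≤-Reasoning
    τ = sum {suc k} (λ i → n C toℕ i)
    twice : ∀ {x} → x ≤ ⌊ n /2⌋ → x + x ≤ suc n
    twice x≤ = ≤-trans (+-mono-≤ x≤ x≤) (≤-trans (2⌊n/2⌋≤n n) (n≤1+n n))
    e₁ : ∀ d t → 4 * (d * d * d) * t ≡ d * (d + d) * ((d + d) * t)
    e₁ = solve-∀
    e₂ : ∀ k d → k + k + (d + d + (d + d)) ≡ k + (d + d) + (k + (d + d))
    e₂ = solve-∀
    e₃ : ∀ d n c → d * (d + d) * (n * c) ≡ n * ((d + d) * (d * c))
    e₃ = solve-∀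
    e₄ : ∀ k d → k + d + (k + d) + (d + d) ≡ k + (d + d) + (k + (d + d))
    e₄ = solve-∀
    2[k+d]≤1+n : k + d + (k + d) ≤ suc n
    2[k+d]≤1+n = twice (≤-trans (+-monoʳ-≤ k (m≤m+n d d)) k+2d≤m)

  -- The upper bound with tolerance 1/k

  module _ (r k : ℕ) where

    private
      -- `a` is the coefficient of `L` once the error of `central-bound` is multiplied by 2k; `b`
      -- ensures `a * L + 2 * d ≤ b * d` for `L = 4 * d + 2` and `d ≥ 1`; `q` turns `d * q ≤ n` into
      -- `b * d ≤ ⌊ n /2⌋`.
      K a b q : ℕ
      K = 2 + r
      a = 4 * (k * K)
      b = 6 * a + 2
      q = suc (b + b)

    -- The error term 1 is shared equally between the flags that are not clean and the two tails;
    -- hence the doubling.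
    size-bound : ∀ n d → 1 ≤ k → 1 ≤ d → b * d ≤ ⌊ n /2⌋ → k * (suc n * suc n) ≤ d * d * d →
      (F : Family n) → S-free r F → k * size F ≤ (k * K + 1) * (n C ⌊ n /2⌋)
    size-bound n d 1≤k 1≤d bd≤m d-large F free = *-cancelˡ-≤ 2 (begin
      2 * (k * size F)                         ≤⟨ *-monoʳ-≤ 2 (*-monoʳ-≤ k size≤) ⟩
      2 * (k * (g + (τ + τ)))                  ≡⟨ e₁ k g τ ⟩
      2 * k * g + 4 * k * τ                    ≤⟨ +-mono-≤ main tail ⟩
      c * (2 * (k * K) + 1) + c                ≡⟨ e₂ c (k * K) ⟩
      2 * ((k * K + 1) * c)                    ∎)
      where
      open ≤-Reasoning
      m = ⌊ n /2⌋
      c = n C m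
      -- The distance 2d from the middle leaves room for both uses of `nC-tail`, at `k₁` and
      -- `k₁ + d`. `L` is then the least value with 2m + 4 ≤ L + 2 `lo`, where n ≤ 2m + 1.
      k₁ = m ∸ (d + d)
      lo = suc k₁
      L = 4 * d + 2
      τ = sum {lo} (λ i → n C toℕ i)
      e₁ : ∀ k g t → 2 * (k * (g + (t + t))) ≡ 2 * k * g + 4 * k * t
      e₁ = solve-∀
      e₂ : ∀ c x → c * (2 * x + 1) + c ≡ 2 * ((x + 1) * c)
      e₂ = solve-∀

      budget : a * L + (d + d) ≤ m
      budget = begin
        a * (4 * d + 2) + (d + d)     ≡⟨ e d a ⟩
        4 * a * d + 2 * a * 1 + 2 * d ≤⟨ +-monoˡ-≤ (2 * d) (+-monoʳ-≤ (4 * a * d) (*-monoʳ-≤ (2 * a) 1≤d)) ⟩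
        4 * a * d + 2 * a * d + 2 * d ≡⟨ e′ d a ⟩
        b * d                         ≤⟨ bd≤m ⟩
        m ∎
        where
        e : ∀ d a → a * (4 * d + 2) + (d + d) ≡ 4 * a * d + 2 * a * 1 + 2 * d
        e = solve-∀
        e′ : ∀ d a → 4 * a * d + 2 * a * d + 2 * d ≡ (6 * a + 2) * d
        e′ = solve-∀
      aL≤k₁ : a * L ≤ k₁
      aL≤k₁ = m+n≤o⇒m≤o∸n (a * L) budget
      2d≤m : d + d ≤ m
      2d≤m = ≤-trans (m≤n+m (d + d) (a * L)) budget
      2≤lo : 2 ≤ lo
      2≤lo = s≤s (≤-trans (*-mono-≤ 1≤a (≤-trans (s≤s z≤n) (m≤n+m 2 (4 * d)))) aL≤k₁)
        where
        1≤a : 1 ≤ a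
        1≤a = *-mono-≤ {1} {4} (s≤s z≤n) (*-mono-≤ 1≤k (s≤s z≤n))
      len : 3 + n ≤ L + (lo + lo)
      len = begin
        3 + n                              ≤⟨ +-monoʳ-≤ 3 (n≤1+2⌊n/2⌋ n) ⟩
        4 + (m + m)                        ≡⟨ cong (λ x → 4 + (x + x)) (sym (m∸n+n≡m 2d≤m)) ⟩
        4 + (k₁ + (d + d) + (k₁ + (d + d))) ≡⟨ e k₁ d ⟩
        L + (lo + lo) ∎
        where
        e : ∀ k d → 4 + (k + (d + d) + (k + (d + d))) ≡ 4 * d + 2 + (suc k + suc k)
        e = solve-∀

      member : Subset n → Bool
      member A = does (A ∈ₗ? members F)
      G : Subset n → Bool
      G A = member A ∧ (lo ≤ᵇ ∣ A ∣) ∧ (lo ≤ᵇ ∣ ∁ A ∣)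
      g = ΣS (χ ∘ G)

      central : ∀ A → G A ≡ true → lo ≤ ∣ A ∣ × lo ≤ ∣ ∁ A ∣
      central A GA with ∧-true (proj₂ (∧-true {member A} GA))
      ... | p , p′ = ≤ᵇ⇒≤ lo _ (subst T (sym p) _) , ≤ᵇ⇒≤ lo _ (subst T (sym p′) _)
      G⇒∈ : ∀ A → G A ≡ true → A L.∈ members F
      G⇒∈ A GA with A ∈ₗ? members F
      ... | yes A∈F = A∈F

      main : 2 * k * g ≤ c * (2 * (k * K) + 1)
      main = *-cancelˡ-≤ lo (begin
        lo * (2 * k * g)                       ≡⟨ p₁ lo k g ⟩
        2 * k * (lo * g)                       ≤⟨ *-monoʳ-≤ (2 * k) (Weights.central-bound G lo central r
                                                    (λ f inj f∈G order → free (f , inj , (λ x → G⇒∈ (f x) (f∈G x)) , order)) L 2≤lo len) ⟩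
        2 * k * (c * (lo * K + K * (L + L)))   ≡⟨ p₂ k c lo K L ⟩
        c * (2 * (k * K) * lo + a * L)         ≤⟨ *-monoʳ-≤ c (+-monoʳ-≤ (2 * (k * K) * lo) (≤-trans aL≤k₁ (n≤1+n k₁))) ⟩
        c * (2 * (k * K) * lo + lo)            ≡⟨ p₃ c (2 * (k * K)) lo ⟩
        lo * (c * (2 * (k * K) + 1))           ∎)
        where
        p₁ : ∀ l k g → l * (2 * k * g) ≡ 2 * k * (l * g)
        p₁ = solve-∀
        p₂ : ∀ k c l K L → 2 * k * (c * (l * K + K * (L + L))) ≡ c * (2 * (k * K) * l + 4 * (k * K) * L)
        p₂ = solve-∀
        p₃ : ∀ c x l → c * (x * l + l) ≡ l * (c * (x + 1))
        p₃ = solve-∀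

      tail : 4 * k * τ ≤ c
      tail = *-cancelˡ-≤ (suc n * suc n) (begin
        suc n * suc n * (4 * k * τ)  ≡⟨ p₁ (suc n * suc n) k τ ⟩
        4 * (k * (suc n * suc n)) * τ ≤⟨ *-monoˡ-≤ τ (*-monoʳ-≤ 4 d-large) ⟩
        4 * (d * d * d) * τ          ≤⟨ lower-tail n d k₁ (≤-reflexive (m∸n+n≡m 2d≤m)) ⟩
        suc n * suc n * c            ∎)
        where
        p₁ : ∀ s k t → s * (4 * k * t) ≡ 4 * (k * s) * t
        p₁ = solve-∀

      low : Subset n → ℕ
      low A = χ (∣ A ∣ <ᵇ lo)
      low≤ : ΣS low ≤ τ
      low≤ = ≤-trans (≤-reflexive (ΣS-levels n (λ i → χ (i <ᵇ lo)))) (sum-cutoff (suc n) lo (n C_))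
      covers : ∀ A → χ (member A) ≤ χ (G A) + (low A + low (∁ A))
      covers A = cases (member A) (lo ≤ᵇ ∣ A ∣) (lo ≤ᵇ ∣ ∁ A ∣) (∣ A ∣ <ᵇ lo) (∣ ∁ A ∣ <ᵇ lo) (dichotomy ∣ A ∣) (dichotomy ∣ ∁ A ∣)
        where
        dichotomy : ∀ s → (lo ≤ᵇ s) ≡ false → (s <ᵇ lo) ≡ true
        dichotomy s eq with s <ᵇ lo in eq′
        ... | true  = refl
        ... | false = contradiction (≤⇒≤ᵇ {lo} {s} (≮⇒≥ λ s<lo → subst T eq′ (<⇒<ᵇ s<lo))) (subst (¬_ ∘ T) (sym eq) λ ())
        cases : ∀ u v w x y → (v ≡ false → x ≡ true) → (w ≡ false → y ≡ true) → χ u ≤ χ (u ∧ v ∧ w) + (χ x + χ y)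
        cases false v w x y p p′ = z≤n
        cases true false w x y p p′ rewrite p refl = s≤s z≤n
        cases true true false x y p p′ rewrite p′ refl = m≤n+m 1 (χ x)
        cases true true true x y p p′ = s≤s z≤n
      size≤ : size F ≤ g + (τ + τ)
      size≤ = begin
        size F                                   ≤⟨ length≤ΣS (members F) (distinct F) ⟩
        ΣS (χ ∘ member)                          ≤⟨ ΣS-mono covers ⟩
        ΣS (λ A → χ (G A) + (low A + low (∁ A))) ≡⟨ trans (ΣS-distrib-+ (χ ∘ G) _) (cong (g +_) (ΣS-distrib-+ low (low ∘ ∁))) ⟩
        g + (ΣS low + ΣS (low ∘ ∁))              ≤⟨ +-monoʳ-≤ g (+-mono-≤ low≤ (≤-trans (≤-reflexive (ΣS-∁ low)) low≤)) ⟩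
        g + (τ + τ)                              ∎

    upper-ℕ : 1 ≤ k → ∃ λ N → ∀ n → n ≥ N → (F : Family n) → S-free r F →
      k * size F ≤ (k * K + 1) * (n C ⌊ n /2⌋)
    -- This threshold gives d ≥ 4kq², and n + 1 ≤ 2qd then yields k(n+1)² ≤ 4kq²d² ≤ d³.
    upper-ℕ 1≤k = 4 * k * (q * q) * q , λ n n≥N →
      let d = n / q
          4kq²≤d : 4 * k * (q * q) ≤ d
          4kq²≤d = ≤-trans (≤-reflexive (sym (m*n/n≡m (4 * k * (q * q)) q))) (/-monoˡ-≤ q n≥N)
          1≤d : 1 ≤ d
          1≤d = ≤-trans (*-mono-≤ {1} {4 * k} (*-mono-≤ {1} {4} (s≤s z≤n) 1≤k) (s≤s z≤n)) 4kq²≤d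
      in size-bound n d 1≤k 1≤d (bd≤m n d 1≤d (m/n*n≤m n q)) (d-large n d 4kq²≤d 1≤d (n<q[1+d] n))
      where
      open ≤-Reasoning
      bd≤m : ∀ n d → 1 ≤ d → d * q ≤ n → b * d ≤ ⌊ n /2⌋
      bd≤m n d 1≤d dq≤n = *-cancelˡ-≤ 2 (s≤s⁻¹ (begin
        1 + 2 * (b * d) ≤⟨ +-monoˡ-≤ (2 * (b * d)) 1≤d ⟩
        d + 2 * (b * d) ≡⟨ e d b ⟩
        d * q           ≤⟨ dq≤n ⟩
        n               ≤⟨ n≤1+2⌊n/2⌋ n ⟩
        suc (⌊ n /2⌋ + ⌊ n /2⌋) ≡⟨ cong (λ x → suc (⌊ n /2⌋ + x)) (+-identityʳ _) ⟨
        suc (2 * ⌊ n /2⌋) ∎))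
        where
        e : ∀ d b → d + 2 * (b * d) ≡ d * suc (b + b)
        e = solve-∀
      n<q[1+d] : ∀ n → suc n ≤ q * (1 + n / q)
      n<q[1+d] n = begin
        suc n ≡⟨ cong suc (m≡m%n+[m/n]*n n q) ⟩
        suc (n % q) + n / q * q ≤⟨ +-monoˡ-≤ (n / q * q) (m%n<n n q) ⟩
        q + n / q * q ≡⟨ *-comm (1 + n / q) q ⟩
        q * (1 + n / q) ∎
      d-large : ∀ n d → 4 * k * (q * q) ≤ d → 1 ≤ d → suc n ≤ q * (1 + d) → k * (suc n * suc n) ≤ d * d * d
      d-large n d 4kq²≤d 1≤d n<q[1+d] = begin
        k * (suc n * suc n)  ≤⟨ *-monoʳ-≤ k (*-mono-≤ n<2qd n<2qd) ⟩
        k * (q * (d + d) * (q * (d + d))) ≡⟨ e k q d ⟩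
        4 * k * (q * q) * d * d ≤⟨ *-monoˡ-≤ d (*-monoˡ-≤ d 4kq²≤d) ⟩
        d * d * d ∎
        where
        n<2qd : suc n ≤ q * (d + d)
        n<2qd = ≤-trans n<q[1+d] (*-monoʳ-≤ q (+-monoˡ-≤ d 1≤d))
        e : ∀ k q d → k * (q * (d + d) * (q * (d + d))) ≡ 4 * k * (q * q) * d * d
        e = solve-∀

  -- Middle levels

  subsets : ∀ n → List (Subset n)
  subsets zero    = [] ∷ []
  subsets (suc n) = map (outside ∷_) (subsets n) ++ map (inside ∷_) (subsets n)

  subsets-Unique : ∀ n → Unique (subsets n)
  subsets-Unique zero    = [] ∷ []
  subsets-Unique (suc n) = Unique.++⁺ (Unique.map⁺ ∷-injectiveʳ (subsets-Unique n)) (Unique.map⁺ ∷-injectiveʳ (subsets-Unique n))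
    λ (p , q) → apart p q
    where
    apart : ∀ {A} → A L.∈ map (outside ∷_) (subsets n) → ¬ A L.∈ map (inside ∷_) (subsets n)
    apart p q with ∈-map⁻ (outside ∷_) p | ∈-map⁻ (inside ∷_) q
    ... | _ , _ , refl | _ , _ , ()

  length-filter-map : ∀ {a b} {A : Set a} {B : Set b} (P : B → Bool) (f : A → B) xs →
    length (filter (λ x → P x Bool.≟ true) (map f xs)) ≡ length (filter (λ x → P (f x) Bool.≟ true) xs)
  length-filter-map P f []       = refl
  length-filter-map P f (x ∷ xs) with P (f x)
  ... | true  = cong suc (length-filter-map P f xs)
  ... | false = length-filter-map P f xs

  length-filter-subsets : ∀ n (P : Subset n → Bool) → length (filter (λ A → P A Bool.≟ true) (subsets n)) ≡ ΣS (χ ∘ P)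
  length-filter-subsets zero    P with P []
  ... | true  = refl
  ... | false = refl
  length-filter-subsets (suc n) P = begin
    length (filter P? (map (outside ∷_) (subsets n) ++ map (inside ∷_) (subsets n)))
      ≡⟨ cong length (filter-++ P? (map (outside ∷_) (subsets n)) _) ⟩
    length (filter P? (map (outside ∷_) (subsets n)) ++ filter P? (map (inside ∷_) (subsets n)))
      ≡⟨ length-++ (filter P? (map (outside ∷_) (subsets n))) ⟩
    length (filter P? (map (outside ∷_) (subsets n))) + length (filter P? (map (inside ∷_) (subsets n)))
      ≡⟨ cong₂ _+_ (trans (length-filter-map P (outside ∷_) (subsets n)) (length-filter-subsets n (P ∘ (outside ∷_))))
                   (trans (length-filter-map P (inside ∷_) (subsets n)) (length-filter-subsets n (P ∘ (inside ∷_)))) ⟩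
    ΣS (χ ∘ P) ∎
    where
    open ≡-Reasoning
    P? = λ A → P A Bool.≟ true

  ∣⊕∣ : ∀ {n} (U : Subset n) e → e ∉ U → ∣ U ⊕ e ∣ ≡ suc ∣ U ∣
  ∣⊕∣ (false ∷ U) zero    _   = refl
  ∣⊕∣ (true ∷ U)  zero    e∉U = contradiction Vec.here e∉U
  ∣⊕∣ (true ∷ U)  (suc e) e∉U = cong suc (∣⊕∣ U e (e∉U ∘ Vec.there))
  ∣⊕∣ (false ∷ U) (suc e) e∉U = ∣⊕∣ U e (e∉U ∘ Vec.there)

  ∣∣+k≤ : ∀ {n} k {A B : Subset n} → A ⊆ B → (e : Fin k → Fin n) → (∀ i j → e i ≡ e j → i ≡ j) →
    (∀ i → e i ∈ B) → (∀ i → e i ∉ A) → ∣ A ∣ + k ≤ ∣ B ∣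
  ∣∣+k≤ zero    A⊆B e inj e∈B e∉A = ≤-trans (≤-reflexive (+-identityʳ _)) (p⊆q⇒∣p∣≤∣q∣ A⊆B)
  ∣∣+k≤ (suc k) {A} {B} A⊆B e inj e∈B e∉A = ≤-trans
    (≤-reflexive (trans (+-suc ∣ A ∣ k) (cong (_+ k) (sym (∣⊕∣ A (e zero) (e∉A zero))))))
    (∣∣+k≤ k {A ⊕ e zero} ⊕⊆B (e ∘ suc) (λ i j eq → Fin.suc-injective (inj (suc i) (suc j) eq)) (e∈B ∘ suc) fresh)
    where
    ⊕⊆B : A ⊕ e zero ⊆ B
    ⊕⊆B x∈ with ∈-⊕⁻ {A = A} x∈
    ... | inj₁ refl = e∈B zero
    ... | inj₂ x∈A  = A⊆B x∈A
    fresh : ∀ i → e (suc i) ∉ A ⊕ e zero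
    fresh i x∈ with ∈-⊕⁻ {A = A} x∈
    ... | inj₁ eq  = contradiction (inj (suc i) zero eq) λ ()
    ... | inj₂ x∈A = e∉A (suc i) x∈A

  ⊈-witness : ∀ {n} {A B : Subset n} → ¬ A ⊆ B → ∃ λ x → x ∈ A × x ∉ B
  ⊈-witness {n} {A} {B} A⊈B with Fin.¬∀⟶∃¬ n (λ x → x ∈ A → x ∈ B) (λ x → (x ∈? A) →-dec (x ∈? B)) (λ h → A⊈B λ {x} → h x)
  ... | x , ¬h = x , decidable-stable (x ∈? A) (λ x∉A → ¬h λ x∈A → contradiction x∈A x∉A) , λ x∈B → ¬h (const x∈B)

  -- a₁ contains b₀ together with the points separating bⱼ from aⱼ for j ≥ 2.
  S-spread : ∀ {n} r (f : Fin (3 + r) ⊎ Fin (3 + r) → Subset n) →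
    (∀ x y → (x ≤S y → f x ⊆ f y) × (f x ⊆ f y → x ≤S y)) →
    ∣ f (inj₂ zero) ∣ + suc r ≤ ∣ f (inj₁ (suc zero)) ∣
  S-spread r f order = ∣∣+k≤ (suc r) (b⊆a λ ()) (λ i → e (suc (suc i)))
    (λ i j eq → Fin.suc-injective (Fin.suc-injective (e-inj _ _ eq)))
    (λ i → b⊆a (λ ()) (e∈b (suc (suc i)))) (λ i e∈b₀ → e∉a (suc (suc i)) (b⊆a (λ ()) e∈b₀))
    where
    b⊆a : ∀ {i j} → i ≢ j → f (inj₂ j) ⊆ f (inj₁ i)
    b⊆a i≢j = proj₁ (order _ _) (b≤a i≢j)
    sep : ∀ j → ∃ λ x → x ∈ f (inj₂ j) × x ∉ f (inj₁ j)
    sep j = ⊈-witness λ b⊆a → irrefl (proj₂ (order _ _) b⊆a)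
      where
      irrefl : ¬ inj₂ j ≤S inj₁ j
      irrefl (b≤a j≢j) = j≢j refl
    e = λ j → proj₁ (sep j)
    e∈b = λ j → proj₁ (proj₂ (sep j))
    e∉a = λ j → proj₂ (proj₂ (sep j))
    e-inj : ∀ i j → e i ≡ e j → i ≡ j
    e-inj i j eq with i Fin.≟ j
    ... | yes i≡j = i≡j
    ... | no  i≢j = contradiction (subst (_∈ f (inj₁ j)) eq (b⊆a (i≢j ∘ sym) (e∈b i))) (e∉a j)

  inLevels : ∀ {n} → ℕ → ℕ → Subset n → Bool
  inLevels m t A = (m ≤ᵇ ∣ A ∣) ∧ (∣ A ∣ <ᵇ m + t)

  levels : ∀ n → ℕ → ℕ → Family n
  levels n m t = family (filter (λ A → inLevels m t A Bool.≟ true) (subsets n)) (Unique.filter⁺ _ (subsets-Unique n))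

  -- For `r ≤ 2` the truncated difference leaves no level at all, and the empty family contains no
  -- copy. Otherwise `S-spread` gives two members whose sizes differ by at least `r − 2`, one more
  -- than `r − 2` consecutive levels allow.
  levels-S-free : ∀ n m r → 1 ≤ r → S-free r (levels n m (r ∸ 2))
  levels-S-free n m r 1≤r (f , _ , f∈ , order) = impossible r 1≤r f f∈ order
    where
    bounds : ∀ t {A} → A L.∈ members (levels n m t) → m ≤ ∣ A ∣ × ∣ A ∣ < m + t
    bounds t {A} A∈ with ∧-true {m ≤ᵇ ∣ A ∣} (proj₂ (∈-filter⁻ (λ A → inLevels m t A Bool.≟ true) {xs = subsets n} A∈))
    ... | p , q = ≤ᵇ⇒≤ m _ (subst T (sym p) _) , <ᵇ⇒< _ _ (subst T (sym q) _)
    empty : ∀ {A} → ¬ A L.∈ members (levels n m 0)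
    empty A∈ with bounds 0 A∈
    ... | p , q = <⇒≱ q (≤-trans (≤-reflexive (+-identityʳ m)) p)
    impossible : ∀ r → 1 ≤ r → (f : Fin r ⊎ Fin r → Subset n) → (∀ x → f x L.∈ members (levels n m (r ∸ 2))) →
      ¬ (∀ x y → (x ≤S y → f x ⊆ f y) × (f x ⊆ f y → x ≤S y))
    impossible 1 _ f f∈ _ = empty (f∈ (inj₁ zero))
    impossible 2 _ f f∈ _ = empty (f∈ (inj₁ zero))
    impossible (suc (suc (suc r))) _ f f∈ order = <-irrefl refl (begin-strict
      ∣ f (inj₁ (suc zero)) ∣       <⟨ proj₂ (bounds (suc r) (f∈ (inj₁ (suc zero)))) ⟩
      m + suc r                     ≤⟨ +-monoˡ-≤ (suc r) (proj₁ (bounds (suc r) (f∈ (inj₂ zero)))) ⟩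
      ∣ f (inj₂ zero) ∣ + suc r     ≤⟨ S-spread r f order ⟩
      ∣ f (inj₁ (suc zero)) ∣       ∎)
      where open ≤-Reasoning

  sum-segment : ∀ N m t (g : ℕ → ℕ) → m + t ≤ N → sum {t} (λ i → g (m + toℕ i)) ≤ sum {N} (g ∘ toℕ)
  sum-segment N       zero    zero    g _         = z≤n
  sum-segment (suc N) zero    (suc t) g (s≤s le)  = +-monoʳ-≤ (g 0) (sum-segment N zero t (g ∘ suc) le)
  sum-segment (suc N) (suc m) t       g (s≤s le)  = ≤-trans (sum-segment N m t (g ∘ suc) le) (m≤n+m _ (g 0))

  size-levels : ∀ n m t → m + t ≤ suc n → sum {t} (λ i → n C (m + toℕ i)) ≤ size (levels n m t)
  size-levels n m t le = begin
    sum {t} (λ i → n C (m + toℕ i)) ≡⟨ sum-cong-≗ {t} (λ i → sym (trans (cong (λ b → (n C (m + toℕ i)) * χ b) (inside′ i)) (*-identityʳ _))) ⟩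
    sum {t} (λ i → (n C (m + toℕ i)) * χ (w (m + toℕ i))) ≤⟨ sum-segment (suc n) m t (λ k → (n C k) * χ (w k)) le ⟩
    sum {suc n} (λ i → (n C toℕ i) * χ (w (toℕ i))) ≡⟨ ΣS-levels n (χ ∘ w) ⟨
    ΣS {n} (λ A → χ (inLevels m t A)) ≡⟨ length-filter-subsets n (inLevels m t) ⟨
    size (levels n m t) ∎
    where
    open ≤-Reasoning
    w : ℕ → Bool
    w k = (m ≤ᵇ k) ∧ (k <ᵇ m + t)
    inside′ : ∀ i → w (m + toℕ i) ≡ true
    inside′ i with m ≤ᵇ m + toℕ i in p | m + toℕ i <ᵇ m + t in q
    ... | true | true = refl
    ... | false | _ = contradiction (subst T p (≤⇒≤ᵇ (m≤m+n m (toℕ i)))) λ ()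
    ... | true | false = contradiction (subst T q (<⇒<ᵇ (+-monoʳ-< m (Fin.toℕ<n i)))) λ ()

  -- The ratio C(2m, m+i+1) / C(2m, m+i) is (m−i)/(m+i+1) ≥ 1 − (2i+1)/m.
  central-decay : ∀ m i → i ≤ m → m * ((m + m) C m) ≤ m * ((m + m) C (m + i)) + i * i * ((m + m) C m)
  central-decay m zero    _   = ≤-reflexive (trans (cong (λ k → m * ((m + m) C k)) (sym (+-identityʳ m))) (sym (+-identityʳ _)))
  central-decay m (suc i) i<m = begin
    m * c                                         ≤⟨ central-decay m i (<⇒≤ i<m) ⟩
    m * x + i * i * c                             ≤⟨ +-monoˡ-≤ (i * i * c) step ⟩
    m * y + (i + suc i) * c + i * i * c           ≡⟨ e₁ m y i c ⟩
    m * y + suc i * suc i * c                     ≡⟨ cong (λ k → m * ((m + m) C k) + suc i * suc i * c) (sym (+-suc m i)) ⟩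
    m * ((m + m) C (m + suc i)) + suc i * suc i * c ∎
    where
    open ≤-Reasoning
    c = (m + m) C m
    x = (m + m) C (m + i)
    y = (m + m) C suc (m + i)
    e₁ : ∀ m y i c → m * y + (i + suc i) * c + i * i * c ≡ m * y + suc i * suc i * c
    e₁ = solve-∀
    j = m ∸ suc i
    m≡ : suc i + j ≡ m
    m≡ = m+[n∸m]≡n i<m
    absorb : y * suc (m + i) ≡ x * suc j
    absorb = subst (λ n → (n C suc (m + i)) * suc (m + i) ≡ (n C (m + i)) * suc j)
      (trans (+-assoc m i (suc j)) (cong (m +_) (trans (+-suc i j) m≡))) (nC[k+1]-absorb (m + i) j)
    mid≤ : x ≤ c
    mid≤ = ≤-trans (nCk≤nC⌊n/2⌋ (m + m) (m + i)) (≤-reflexive (cong ((m + m) C_) (sym (n≡⌊n+n/2⌋ m))))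
    -- Here `suc j` is m - i, and m + i + 1 splits as (m - i) + (2i + 1). The losses 2i + 1 of
    -- successive steps add up to a square.
    step : m * x ≤ m * y + (i + suc i) * c
    step = *-cancelʳ-≤ _ _ (suc (m + i)) (begin
      m * x * suc (m + i)                        ≡⟨ cong (λ k → m * x * suc (k + i)) (sym m≡) ⟩
      m * x * suc (suc i + j + i)                ≡⟨ s₁ m x i j ⟩
      m * (x * suc j) + (i + suc i) * (m * x)    ≡⟨ cong (λ z → m * z + (i + suc i) * (m * x)) (sym absorb) ⟩
      m * (y * suc (m + i)) + (i + suc i) * (m * x)
        ≤⟨ +-monoʳ-≤ (m * (y * suc (m + i))) (*-monoʳ-≤ (i + suc i) (*-mono-≤ (≤-trans (m≤m+n m i) (n≤1+n _)) mid≤)) ⟩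
      m * (y * suc (m + i)) + (i + suc i) * (suc (m + i) * c) ≡⟨ s₂ m y (m + i) (i + suc i) c ⟩
      (m * y + (i + suc i) * c) * suc (m + i) ∎)
      where
      s₁ : ∀ m x i j → m * x * suc (suc i + j + i) ≡ m * (x * suc j) + (i + suc i) * (m * x)
      s₁ = solve-∀
      s₂ : ∀ m y k d c → m * (y * suc k) + d * (suc k * c) ≡ (m * y + d * c) * suc k
      s₂ = solve-∀

  -- In even dimension 2m take the `t` levels from the middle upwards; by `central-decay` each falls
  -- short of the middle one by at most t²/m of it, together t³/m.
  lower-ℕ : ∀ r k N → 1 ≤ r → ∃ λ n → n ≥ N × Σ (Family n) λ F → S-free r F ×
    k * ((r ∸ 2) * (n C ⌊ n /2⌋)) ≤ k * size F + (n C ⌊ n /2⌋)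
  lower-ℕ r k N 1≤r = m + m , ≤-trans (≤-trans (m≤n+m N (t + k * (t * t * t))) (n≤1+n _)) (m≤m+n m m) ,
    levels (m + m) m t , levels-S-free (m + m) m r 1≤r ,
    subst (λ h → k * (t * ((m + m) C h)) ≤ k * size (levels (m + m) m t) + ((m + m) C h)) (n≡⌊n+n/2⌋ m) bound
    where
    open ≤-Reasoning
    t = r ∸ 2
    -- Room for `t` levels, a total loss of at most 1/k of the middle level, and dimension at least
    -- `N`.
    m = suc (t + k * (t * t * t) + N)
    c = (m + m) C m
    s = sum {t} (λ i → (m + m) C (m + toℕ i))
    t≤m : t ≤ m
    t≤m = ≤-trans (≤-trans (m≤m+n t _) (m≤m+n _ N)) (n≤1+n _)
    kt³≤m : k * (t * t * t) ≤ m
    kt³≤m = ≤-trans (≤-trans (m≤n+m _ t) (m≤m+n _ N)) (n≤1+n _)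
    sum≥ : m * (t * c) ≤ m * s + t * (t * t * c)
    sum≥ = begin
      m * (t * c)       ≡⟨ *-left-comm m t c ⟩
      t * (m * c)       ≡⟨ sum-const t (m * c) ⟨
      sum {t} (λ _ → m * c)
        ≤⟨ sum-mono {t} (λ i → ≤-trans (central-decay m (toℕ i) (≤-trans (<⇒≤ (Fin.toℕ<n i)) t≤m))
             (+-monoʳ-≤ _ (*-monoˡ-≤ c (*-mono-≤ (<⇒≤ (Fin.toℕ<n i)) (<⇒≤ (Fin.toℕ<n i)))))) ⟩
      sum {t} (λ i → m * ((m + m) C (m + toℕ i)) + t * t * c) ≡⟨ ∑-distrib-+ {t} (λ i → m * ((m + m) C (m + toℕ i))) _ ⟩
      sum {t} (λ i → m * ((m + m) C (m + toℕ i))) + sum {t} (λ _ → t * t * c)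
        ≡⟨ cong₂ _+_ (sym (*-distribˡ-sum {t} m (λ i → (m + m) C (m + toℕ i)))) (sum-const t (t * t * c)) ⟩
      m * s + t * (t * t * c) ∎
    bound : k * (t * c) ≤ k * size (levels (m + m) m t) + c
    bound = *-cancelˡ-≤ m (begin
      m * (k * (t * c))                   ≡⟨ *-left-comm m k (t * c) ⟩
      k * (m * (t * c))                   ≤⟨ *-monoʳ-≤ k sum≥ ⟩
      k * (m * s + t * (t * t * c))       ≡⟨ e₂ k m s t c ⟩
      m * (k * s) + k * (t * t * t) * c   ≤⟨ +-mono-≤ (*-monoʳ-≤ m (*-monoʳ-≤ k (size-levels (m + m) m t (≤-trans (+-monoʳ-≤ m t≤m) (n≤1+n _)))))
                                              (*-monoˡ-≤ c kt³≤m) ⟩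
      m * (k * size (levels (m + m) m t)) + m * c ≡⟨ *-distribˡ-+ m _ c ⟨
      m * (k * size (levels (m + m) m t) + c) ∎)
      where
      e₂ : ∀ k m s t c → k * (m * s + t * (t * t * c)) ≡ m * (k * s) + k * (t * t * t) * c
      e₂ = solve-∀

-- Passage to the rationals

open Counting using (lower-ℕ; upper-ℕ)
open import Data.Nat using (ℕ; NonZero; suc; z≤n; s≤s)
import Data.Nat as ℕ
import Data.Nat.Properties as ℕ
open import Data.Nat.Combinatorics using (_C_)
open import Data.Integer using (+_; -_; +≤+)
import Data.Integer as ℤ
import Data.Integer.Properties as ℤ
open import Data.Rational using (ℚ; mkℚ; _/_; _+_; _-_; _*_; _≤_; NonNegative; Positive; toℚᵘ; 0ℚ)
import Data.Rational as ℚ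
open import Data.Rational.Properties
open import Data.Rational.Solver using (module +-*-Solver)
open import Data.Rational.Unnormalised using (mkℚᵘ; *≡*; *≤*) renaming (_+_ to _+ᵘ_; _*_ to _*ᵘ_; _≃_ to _≃ᵘ_)
import Data.Rational.Unnormalised.Properties as ℚᵘ
open import Data.Product using (Σ; _×_; _,_; ∃; proj₁; proj₂)
open import Relation.Binary.PropositionalEquality

private
  -- `_/_` normalises by a gcd; the unnormalised representative has denominator 1 on the nose, so
  -- the arithmetic of `ℕ→ℚ` is checked there.
  toℚᵘ-ℕ→ℚ : ∀ n → toℚᵘ (ℕ→ℚ n) ≃ᵘ mkℚᵘ (+ n) 0
  toℚᵘ-ℕ→ℚ n = toℚᵘ-fromℚᵘ (mkℚᵘ (+ n) 0)

ℕ→ℚ-+ : ∀ m n → ℕ→ℚ (m ℕ.+ n) ≡ ℕ→ℚ m + ℕ→ℚ n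
ℕ→ℚ-+ m n = toℚᵘ-injective (begin
  toℚᵘ (ℕ→ℚ (m ℕ.+ n))              ≈⟨ toℚᵘ-ℕ→ℚ (m ℕ.+ n) ⟩
  mkℚᵘ (+ (m ℕ.+ n)) 0              ≈⟨ *≡* (cong (ℤ._* + 1) (sym (cong₂ ℤ._+_ (ℤ.*-identityʳ (+ m)) (ℤ.*-identityʳ (+ n))))) ⟩
  mkℚᵘ (+ m) 0 +ᵘ mkℚᵘ (+ n) 0      ≈⟨ ℚᵘ.+-cong (toℚᵘ-ℕ→ℚ m) (toℚᵘ-ℕ→ℚ n) ⟨
  toℚᵘ (ℕ→ℚ m) +ᵘ toℚᵘ (ℕ→ℚ n)      ≈⟨ toℚᵘ-homo-+ (ℕ→ℚ m) (ℕ→ℚ n) ⟨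
  toℚᵘ (ℕ→ℚ m + ℕ→ℚ n)              ∎)
  where open ℚᵘ.≃-Reasoning

ℕ→ℚ-* : ∀ m n → ℕ→ℚ (m ℕ.* n) ≡ ℕ→ℚ m * ℕ→ℚ n
ℕ→ℚ-* m n = toℚᵘ-injective (begin
  toℚᵘ (ℕ→ℚ (m ℕ.* n))              ≈⟨ toℚᵘ-ℕ→ℚ (m ℕ.* n) ⟩
  mkℚᵘ (+ (m ℕ.* n)) 0              ≈⟨ *≡* (cong (ℤ._* + 1) (ℤ.pos-* m n)) ⟩
  mkℚᵘ (+ m) 0 *ᵘ mkℚᵘ (+ n) 0      ≈⟨ ℚᵘ.*-cong (toℚᵘ-ℕ→ℚ m) (toℚᵘ-ℕ→ℚ n) ⟨
  toℚᵘ (ℕ→ℚ m) *ᵘ toℚᵘ (ℕ→ℚ n)      ≈⟨ toℚᵘ-homo-* (ℕ→ℚ m) (ℕ→ℚ n) ⟨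
  toℚᵘ (ℕ→ℚ m * ℕ→ℚ n)              ∎)
  where open ℚᵘ.≃-Reasoning

ℕ→ℚ-mono : ∀ {m n} → m ℕ.≤ n → ℕ→ℚ m ≤ ℕ→ℚ n
ℕ→ℚ-mono {m} {n} m≤n = toℚᵘ-cancel-≤ (begin
  toℚᵘ (ℕ→ℚ m) ≃⟨ toℚᵘ-ℕ→ℚ m ⟩
  mkℚᵘ (+ m) 0 ≤⟨ *≤* (ℤ.*-monoʳ-≤-nonNeg (+ 1) (+≤+ m≤n)) ⟩
  mkℚᵘ (+ n) 0 ≃⟨ toℚᵘ-ℕ→ℚ n ⟨
  toℚᵘ (ℕ→ℚ n) ∎)
  where open ℚᵘ.≤-Reasoning

-- The denominator of `ε` will do, since its numerator is at least 1.
archimedean : ∀ ε → Positive ε → ∃ λ k → 1 ℕ.≤ k × ℕ→ℚ 1 ≤ ε * ℕ→ℚ k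
archimedean ε@(mkℚ (ℤ.+[1+ p ]) d _) _ = suc d , s≤s z≤n , toℚᵘ-cancel-≤ (begin
  mkℚᵘ (+ 1) 0                              ≤⟨ *≤* (+≤+ bound) ⟩
  mkℚᵘ (+ suc p) d *ᵘ mkℚᵘ (+ suc d) 0      ≃⟨ ℚᵘ.*-cong (ℚᵘ.≃-refl {toℚᵘ ε}) (toℚᵘ-ℕ→ℚ (suc d)) ⟨
  toℚᵘ ε *ᵘ toℚᵘ (ℕ→ℚ (suc d))              ≃⟨ toℚᵘ-homo-* ε (ℕ→ℚ (suc d)) ⟨
  toℚᵘ (ε * ℕ→ℚ (suc d))                    ∎)
  where
  open ℚᵘ.≤-Reasoning
  bound : 1 ℕ.* (suc d ℕ.* 1) ℕ.≤ suc p ℕ.* suc d ℕ.* 1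
  bound = ℕ.≤-trans (ℕ.≤-reflexive (ℕ.*-identityˡ (suc d ℕ.* 1))) (ℕ.*-monoˡ-≤ 1 (ℕ.m≤n*m (suc d) (suc p)))

ℕ→ℚ-nonNeg : ∀ n → NonNegative (ℕ→ℚ n)
ℕ→ℚ-nonNeg n = normalize-nonNeg n 1

cancel-≤ : ∀ k {p q} → 1 ℕ.≤ k → p * ℕ→ℚ k ≤ q * ℕ→ℚ k → p ≤ q
cancel-≤ (suc k) _ = *-cancelʳ-≤-pos (ℕ→ℚ (suc k)) {{normalize-pos (suc k) 1}}

mono-*ʳ : ∀ n {p q} → p ≤ q → p * ℕ→ℚ n ≤ q * ℕ→ℚ n
mono-*ʳ n = *-monoʳ-≤-nonNeg (ℕ→ℚ n) {{ℕ→ℚ-nonNeg n}}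

-- With `k` times `ε` at least 1, the 1 in `k * K + 1` is absorbed by `ε`; the common factor `k` is
-- cancelled last.
upper : ∀ r c → ℕ→ℚ (2 ℕ.+ r) ≤ c → UpperBoundπ* r c
upper r c K≤c ε ε>0 = from (archimedean ε ε>0)
  where
  regroup : ∀ c k e b → (c * k + e * k) * b ≡ (c + e) * b * k
  regroup = solve 4 (λ c k e b → (c :* k :+ e :* k) :* b := (c :+ e) :* b :* k) refl
    where open +-*-Solver
  scaled : ∀ k → 1 ℕ.≤ k → ℕ→ℚ 1 ≤ ε * ℕ→ℚ k → ∀ m b →
    k ℕ.* m ℕ.≤ (k ℕ.* (2 ℕ.+ r) ℕ.+ 1) ℕ.* b → ℕ→ℚ m ≤ (c + ε) * ℕ→ℚ b
  scaled k 1≤k 1≤εk m b bound = cancel-≤ k 1≤k (begin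
    ℕ→ℚ m * ℕ→ℚ k                    ≡⟨ trans (*-comm (ℕ→ℚ m) (ℕ→ℚ k)) (sym (ℕ→ℚ-* k m)) ⟩
    ℕ→ℚ (k ℕ.* m)                    ≤⟨ ℕ→ℚ-mono bound ⟩
    ℕ→ℚ ((k ℕ.* (2 ℕ.+ r) ℕ.+ 1) ℕ.* b)
      ≡⟨ trans (ℕ→ℚ-* (k ℕ.* (2 ℕ.+ r) ℕ.+ 1) b) (cong (_* ℕ→ℚ b) (trans (ℕ→ℚ-+ (k ℕ.* (2 ℕ.+ r)) 1) (cong (_+ ℕ→ℚ 1) (ℕ→ℚ-* k (2 ℕ.+ r))))) ⟩
    (ℕ→ℚ k * ℕ→ℚ (2 ℕ.+ r) + ℕ→ℚ 1) * ℕ→ℚ b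
      ≤⟨ mono-*ʳ b (+-mono-≤ (≤-trans (≤-reflexive (*-comm (ℕ→ℚ k) _)) (mono-*ʳ k K≤c)) 1≤εk) ⟩
    (c * ℕ→ℚ k + ε * ℕ→ℚ k) * ℕ→ℚ b  ≡⟨ regroup c (ℕ→ℚ k) ε (ℕ→ℚ b) ⟩
    (c + ε) * ℕ→ℚ b * ℕ→ℚ k          ∎)
    where open ≤-Reasoning
  from : (∃ λ k → 1 ℕ.≤ k × ℕ→ℚ 1 ≤ ε * ℕ→ℚ k) →
    ∃ λ N → (n : ℕ) → n ℕ.≥ N → (F : Family n) → S-free r F → F ≤·mid (c + ε)
  from (k , 1≤k , 1≤εk) = proj₁ (upper-ℕ r k 1≤k) , λ n n≥N F free →
    scaled k 1≤k 1≤εk (size F) (n C ℕ.⌊ n /2⌋) (proj₂ (upper-ℕ r k 1≤k) n n≥N F free)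

lower : ∀ r → 1 ℕ.≤ r → ∀ c → c ≤ ℕ→ℚ (r ℕ.∸ 2) → LowerBoundπ* r c
lower r 1≤r c c≤t ε ε>0 N = from (archimedean ε ε>0)
  where
  t = r ℕ.∸ 2
  regroup : ∀ k s e b → k * s + e * k * b ≡ (s + e * b) * k
  regroup = solve 4 (λ k s e b → k :* s :+ e :* k :* b := (s :+ e :* b) :* k) refl
    where open +-*-Solver
  scaled : ∀ k → 1 ℕ.≤ k → ℕ→ℚ 1 ≤ ε * ℕ→ℚ k → ∀ m b →
    k ℕ.* (t ℕ.* b) ℕ.≤ k ℕ.* m ℕ.+ b → c * ℕ→ℚ b ≤ ℕ→ℚ m + ε * ℕ→ℚ b
  scaled k 1≤k 1≤εk m b bound = cancel-≤ k 1≤k (begin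
    c * ℕ→ℚ b * ℕ→ℚ k                  ≤⟨ mono-*ʳ k (mono-*ʳ b c≤t) ⟩
    ℕ→ℚ t * ℕ→ℚ b * ℕ→ℚ k              ≡⟨ trans (*-comm (ℕ→ℚ t * ℕ→ℚ b) (ℕ→ℚ k)) (trans (cong (ℕ→ℚ k *_) (sym (ℕ→ℚ-* t b))) (sym (ℕ→ℚ-* k (t ℕ.* b)))) ⟩
    ℕ→ℚ (k ℕ.* (t ℕ.* b))              ≤⟨ ℕ→ℚ-mono bound ⟩
    ℕ→ℚ (k ℕ.* m ℕ.+ b)                ≡⟨ trans (ℕ→ℚ-+ (k ℕ.* m) b) (cong₂ _+_ (ℕ→ℚ-* k m) (sym (*-identityˡ (ℕ→ℚ b)))) ⟩
    ℕ→ℚ k * ℕ→ℚ m + ℕ→ℚ 1 * ℕ→ℚ b      ≤⟨ +-monoʳ-≤ (ℕ→ℚ k * ℕ→ℚ m) (mono-*ʳ b 1≤εk) ⟩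
    ℕ→ℚ k * ℕ→ℚ m + ε * ℕ→ℚ k * ℕ→ℚ b  ≡⟨ regroup (ℕ→ℚ k) (ℕ→ℚ m) ε (ℕ→ℚ b) ⟩
    (ℕ→ℚ m + ε * ℕ→ℚ b) * ℕ→ℚ k        ∎)
    where open ≤-Reasoning
  from : (∃ λ k → 1 ℕ.≤ k × ℕ→ℚ 1 ≤ ε * ℕ→ℚ k) →
    ∃ λ n → n ℕ.≥ N × Σ (Family n) λ F → S-free r F ×
      c * ℕ→ℚ (n C ℕ.⌊ n /2⌋) ≤ ℕ→ℚ (size F) + ε * ℕ→ℚ (n C ℕ.⌊ n /2⌋)
  from (k , 1≤k , 1≤εk) = conclude (lower-ℕ r k N 1≤r)
    where
    conclude : (∃ λ n → n ℕ.≥ N × Σ (Family n) λ F → S-free r F ×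
        k ℕ.* (t ℕ.* (n C ℕ.⌊ n /2⌋)) ℕ.≤ k ℕ.* size F ℕ.+ (n C ℕ.⌊ n /2⌋)) → _
    conclude (n , n≥N , F , free , bound) =
      n , n≥N , F , free , scaled k 1≤k 1≤εk (size F) (n C ℕ.⌊ n /2⌋) bound

-- The square root of r enters through the nonnegative rationals `s` with r ≤ s²; they come
-- arbitrarily close to it, so the bounds for all such `s` together express the real one.
theorem3p13 : (r : ℕ) → .{{_ : NonZero r}} →
    LowerBoundπ* r (ℕ→ℚ r - ℕ→ℚ 2) ×
    ((s : ℚ) → NonNegative s → ℕ→ℚ r ≤ s * s →
    UpperBoundπ* r (ℕ→ℚ r + ℕ→ℚ 2 * s + ℕ→ℚ 6))
theorem3p13 r = lower r (ℕ.>-nonZero⁻¹ r) (ℕ→ℚ r - ℕ→ℚ 2) r-2≤ , λ s s≥0 _ → upper r (ℕ→ℚ r + ℕ→ℚ 2 * s + ℕ→ℚ 6) (2+r≤ s s≥0)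
  where
  open ≤-Reasoning
  -- Only an inequality: for `r = 1` the left side is -1 and the right side 0.
  r-2≤ : ℕ→ℚ r - ℕ→ℚ 2 ≤ ℕ→ℚ (r ℕ.∸ 2)
  r-2≤ = begin
    ℕ→ℚ r - ℕ→ℚ 2                      ≤⟨ +-monoˡ-≤ (ℚ.- ℕ→ℚ 2) (ℕ→ℚ-mono (ℕ.m≤n+m∸n r 2)) ⟩
    ℕ→ℚ (2 ℕ.+ (r ℕ.∸ 2)) - ℕ→ℚ 2      ≡⟨ cong (_- ℕ→ℚ 2) (ℕ→ℚ-+ 2 (r ℕ.∸ 2)) ⟩
    ℕ→ℚ 2 + ℕ→ℚ (r ℕ.∸ 2) - ℕ→ℚ 2      ≡⟨ cancel (ℕ→ℚ 2) (ℕ→ℚ (r ℕ.∸ 2)) ⟩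
    ℕ→ℚ (r ℕ.∸ 2)                      ∎
    where
    cancel : ∀ x y → x + y - x ≡ y
    cancel = solve 2 (λ x y → x :+ y :- x := y) refl
      where open +-*-Solver
  2+r≤ : ∀ s → NonNegative s → ℕ→ℚ (2 ℕ.+ r) ≤ ℕ→ℚ r + ℕ→ℚ 2 * s + ℕ→ℚ 6
  2+r≤ s s≥0 = begin
    ℕ→ℚ (2 ℕ.+ r)                      ≡⟨ trans (cong ℕ→ℚ (ℕ.+-comm 2 r)) (ℕ→ℚ-+ r 2) ⟩
    ℕ→ℚ r + ℕ→ℚ 2                      ≡⟨ cong (_+ ℕ→ℚ 2) (+-identityʳ (ℕ→ℚ r)) ⟨
    ℕ→ℚ r + 0ℚ + ℕ→ℚ 2                 ≤⟨ +-mono-≤ (+-monoʳ-≤ (ℕ→ℚ r) 0≤2s) (ℕ→ℚ-mono {2} {6} (s≤s (s≤s z≤n))) ⟩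
    ℕ→ℚ r + ℕ→ℚ 2 * s + ℕ→ℚ 6          ∎
    where
    0≤2s : 0ℚ ≤ ℕ→ℚ 2 * s
    0≤2s = nonNegative⁻¹ (ℕ→ℚ 2 * s) {{nonNeg*nonNeg⇒nonNeg (ℕ→ℚ 2) s {{s≥0}}}}
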